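{- Let $\mathbb{F}$ be a nonabelian free group. Then the complete first-order theory of $\mathbb{F}$ (in the language of groups) is not equational.
   Context: Let $T$ be a first-order theory. A formula $\varphi(x,y)$ is an equation in the tuple $x$ (modulo $T$) if every collection of instances $\{\varphi(x,b)\}_b$ (parameters $b$ from a model of $T$) is equivalent modulo $T$ to a finite subcollection. $T$ is $n$-equational if every formula $\varphi(x,y)$ with $|x|=n$ is equivalent modulo $T$ to a boolean combination of equations in $x$; $T$ is equational if it is $n$-equational for every $n<\omega$. -}

module Defs where

open import Level using (0ℓ)
open import Data.Nat using (ℕ; suc; _+_)
open import Data.Fin using (Fin; zero; suc)
open import Data.Unit using (⊤)
open import Data.Empty using (⊥)
open import Data.Product using (Σ; _×_; ∃)
open import Data.Sum using (_⊎_)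
open import Data.List using (List)
open import Data.List.Relation.Unary.All using (All)
open import Data.Vec.Functional using (Vector; _++_)
open import Relation.Nullary using (¬_)
open import Algebra.Bundles using (Group)
open import Algebra.Morphism.Structures using (module GroupMorphisms)

data Term (n : ℕ) : Set where
  var  : Fin n → Term n
  e'   : Term n
  _·'_ : Term n → Term n → Term n
  inv' : Term n → Term n

data Formula (n : ℕ) : Set where
  _≐_  : Term n → Term n → Formula n
  ⊤'   : Formula n
  ⊥'   : Formula n
  ¬'_  : Formula n → Formula n
  _∧'_ : Formula n → Formula n → Formula n
  _∨'_ : Formula n → Formula n → Formula n
  _⇒'_ : Formula n → Formula n → Formula n
  ∀'   : Formula (suc n) → Formula n
  ∃'   : Formula (suc n) → Formula n

Sentence : Set
Sentence = Formula 0

-- L-structures for the language of groups; equality is interpreted by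
-- a congruence _≈_ (setoid-style, as in the stdlib algebra hierarchy).
record Structure : Set₁ where
  field
    Carrier : Set
    _≈_     : Carrier → Carrier → Set
    op      : Carrier → Carrier → Carrier
    inv     : Carrier → Carrier
    unit    : Carrier
    ≈-refl  : ∀ {a} → a ≈ a
    ≈-sym   : ∀ {a b} → a ≈ b → b ≈ a
    ≈-trans : ∀ {a b c} → a ≈ b → b ≈ c → a ≈ c
    op-cong  : ∀ {a a' b b'} → a ≈ a' → b ≈ b' → op a b ≈ op a' b'
    inv-cong : ∀ {a a'} → a ≈ a' → inv a ≈ inv a'

open Structure public

extend : {A : Set} {n : ℕ} → A → (Fin n → A) → Fin (suc n) → A
extend a ρ zero    = a
extend a ρ (suc i) = ρ i

evalT : (M : Structure) {n : ℕ} → Term n → (Fin n → Carrier M) → Carrier M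
evalT M (var i)  ρ = ρ i
evalT M e'       ρ = unit M
evalT M (s ·' t) ρ = op M (evalT M s ρ) (evalT M t ρ)
evalT M (inv' t) ρ = inv M (evalT M t ρ)

Sat : (M : Structure) {n : ℕ} → Formula n → (Fin n → Carrier M) → Set
Sat M (s ≐ t)  ρ = _≈_ M (evalT M s ρ) (evalT M t ρ)
Sat M ⊤'       ρ = ⊤
Sat M ⊥'       ρ = ⊥
Sat M (¬' φ)   ρ = ¬ Sat M φ ρ
Sat M (φ ∧' ψ) ρ = Sat M φ ρ × Sat M ψ ρ
Sat M (φ ∨' ψ) ρ = Sat M φ ρ ⊎ Sat M ψ ρ
Sat M (φ ⇒' ψ) ρ = Sat M φ ρ → Sat M ψ ρ
Sat M (∀' φ)   ρ = (a : Carrier M) → Sat M φ (extend a ρ)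
Sat M (∃' φ)   ρ = Σ (Carrier M) λ a → Sat M φ (extend a ρ)

emptyAssign : {A : Set} → Fin 0 → A
emptyAssign ()

Theory : Set₁
Theory = Sentence → Set

_⊨S_ : Structure → Sentence → Set
M ⊨S σ = Sat M σ emptyAssign

Model : Theory → Structure → Set
Model T M = (σ : Sentence) → T σ → M ⊨S σ

Th : Structure → Theory
Th M σ = M ⊨S σ

EquivMod : Theory → {k : ℕ} → Formula k → Formula k → Set₁
EquivMod T φ ψ = (M : Structure) → Model T M → (ρ : Fin _ → Carrier M) →
  (Sat M φ ρ → Sat M ψ ρ) × (Sat M ψ ρ → Sat M φ ρ)

-- φ(x,y) with x = the first n variables and y = the last m variables
-- is an equation in x modulo T: in every model M of T, every family of
-- instances {φ(x,b_i)}_{i∈I} (b_i parameters from M) is equivalent to a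
-- finite subfamily {φ(x,b_j)}_{j∈J}.
IsEquation : Theory → (n m : ℕ) → Formula (n + m) → Set₁
IsEquation T n m φ =
  (M : Structure) → Model T M →
  (I : Set) (b : I → Vector (Carrier M) m) →
  Σ (List I) λ J →
    (a : Vector (Carrier M) n) →
    All (λ j → Sat M φ (a ++ b j)) J →
    (i : I) → Sat M φ (a ++ b i)

data BoolComb {k : ℕ} (P : Formula k → Set₁) : Formula k → Set₁ where
  atom : ∀ {φ} → P φ → BoolComb P φ
  neg  : ∀ {φ} → BoolComb P φ → BoolComb P (¬' φ)
  conj : ∀ {φ ψ} → BoolComb P φ → BoolComb P ψ → BoolComb P (φ ∧' ψ)
  disj : ∀ {φ ψ} → BoolComb P φ → BoolComb P ψ → BoolComb P (φ ∨' ψ)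

NEquational : Theory → ℕ → Set₁
NEquational T n = (m : ℕ) (φ : Formula (n + m)) →
  Σ (Formula (n + m)) λ ψ → BoolComb (IsEquation T n m) ψ × EquivMod T φ ψ

Equational : Theory → Set₁
Equational T = (n : ℕ) → NEquational T n

groupStructure : Group 0ℓ 0ℓ → Structure
groupStructure G = record
  { Carrier = Group.Carrier G
  ; _≈_ = Group._≈_ G
  ; op = Group._∙_ G
  ; inv = Group._⁻¹ G
  ; unit = Group.ε G
  ; ≈-refl = Group.refl G
  ; ≈-sym = Group.sym G
  ; ≈-trans = Group.trans G
  ; op-cong = Group.∙-cong G
  ; inv-cong = Group.⁻¹-cong G
  }

IsGroupHom : (G H : Group 0ℓ 0ℓ) → (Group.Carrier G → Group.Carrier H) → Set
IsGroupHom G H = GroupMorphisms.IsGroupHomomorphism (Group.rawGroup G) (Group.rawGroup H)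

IsFreeOn : (X : Set) (F : Group 0ℓ 0ℓ) → (X → Group.Carrier F) → Set₁
IsFreeOn X F ι =
  (H : Group 0ℓ 0ℓ) (f : X → Group.Carrier H) →
  Σ (Group.Carrier F → Group.Carrier H) λ h →
    IsGroupHom F H h ×
    ((x : X) → Group._≈_ H (h (ι x)) (f x)) ×
    ((h' : Group.Carrier F → Group.Carrier H) → IsGroupHom F H h' →
      ((x : X) → Group._≈_ H (h' (ι x)) (f x)) →
      (g : Group.Carrier F) → Group._≈_ H (h g) (h' g))

NonAbelian : Group 0ℓ 0ℓ → Set
NonAbelian G = ∃ λ x → ∃ λ y → ¬ Group._≈_ G (Group._∙_ G x y) (Group._∙_ G y x)

{-# OPTIONS --safe #-}

-- Let e₁, e₂ be two generators of F.  By conjugation invariance, the truth of a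
-- formula at the conjugates of (e₁,e₂) by x and by y depends only on x⁻¹y, so an
-- equation cuts out a set S ⊆ F that is closed in the following sense: if the
-- elements xₖ⁻¹yₖ all equal g and xᵢ⁻¹yⱼ ∈ S for all j < i, then g ∈ S.  Let
--
--   D = { g u s u⁻¹ : 1 ≠ s ∈ C(e₁), u = [g⁻¹,e₁]² }.
--
-- Every g ∈ F is the diagonal value of a sequence whose off-diagonal values all
-- lie in D, and of another one whose off-diagonal values all avoid D.  The first
-- is visible from the definition.  For the second, represent F in ℤ ≀ ℤ with e₁
-- the shift t and e₂ a single lamp: a member of D has lamps
-- p + 2(t − 1)(1 − tⁿ)p with n ≠ 0, whose top coefficient is even, and
-- multiplying g by a single lamp lit far to the right makes it odd.
--
-- If D were a Boolean combination of closed sets, Ramsey's theorem would give,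
-- for every g, an off-diagonal value lying in strictly fewer of them than g
-- does: an infinite descent.  The classical reasoning is licensed by the
-- hypothesis itself, since a refutable equation yields excluded middle.
module Submission where

open import Defs hiding (Carrier; _≈_; op; inv; unit; ≈-refl; ≈-sym; ≈-trans; op-cong; inv-cong)
open import Level using (0ℓ)
open import Algebra.Bundles using (Group)
open import Algebra.Morphism.Structures using (module GroupMorphisms)
import Algebra.Properties.Group as GroupProperties
open import Axiom.ExcludedMiddle using (ExcludedMiddle)
open import Data.Bool using (Bool; true; false; not)
open import Data.Empty using (⊥)
open import Data.Fin using (Fin; zero; suc)
open import Data.Integer using (ℤ; +_; -[1+_]; 0ℤ; 1ℤ; ∣_∣; +<+)
import Data.Integer as ℤ
import Data.Integer.Properties as ℤ
open import Data.Integer.Tactic.RingSolver using (solve-∀)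
open import Data.List using (List; []; _∷_; _∷ʳ_)
import Data.List as List
import Data.List.Properties as List
open import Data.List.Relation.Unary.All using (All; []; _∷_)
import Data.List.Relation.Unary.All as All
import Data.List.Relation.Unary.All.Properties as All
open import Data.Nat using (ℕ; zero; suc; z≤n; s≤s; z<s; s<s)
import Data.Nat as ℕ
import Data.Nat.Properties as ℕ
open import Data.Product using (Σ; ∃; _×_; _,_; proj₁; proj₂)
import Data.Product as Product
open import Data.Sum using (_⊎_; inj₁; inj₂; [_,_]′)
import Data.Sum as Sum
open import Data.Unit using (⊤; tt)
open import Data.Vec.Functional using (Vector; _++_)
open import Function using (_∘_; id)
open import Relation.Binary.PropositionalEquality as ≡ using (_≡_; _≢_; refl; cong; cong₂)
import Relation.Binary.Reasoning.Setoid as SetoidReasoning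
open import Relation.Nullary using (¬_; yes; no; contradiction)

-- The twisting word in an arbitrary group

module Twist (G : Group 0ℓ 0ℓ) where
  open Group G using (Carrier; _∙_; _⁻¹)

  -- With `e` the shift of ℤ ≀ ℤ, the commutator `v` has position 0, so squaring it doubles its
  -- lamps. All lamps of `u` are therefore even.
  u : Carrier → Carrier → Carrier
  u e g = v ∙ v
    where
    v : Carrier
    v = g ⁻¹ ∙ (e ∙ (g ∙ e ⁻¹))

  twist : Carrier → Carrier → Carrier → Carrier
  twist e g s = g ∙ (u e g ∙ (s ∙ u e g ⁻¹))

-- The lamplighter group ℤ ≀ ℤ and the parity of the top lamp

module Lamplighter where
  open import Data.Integer using (_+_; _*_; -_; _-_; _<_; _≤_)
  open ≡ using (sym; trans; subst; module ≡-Reasoning)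

  i<i+1+n : ∀ i n → i < i + + suc n
  i<i+1+n i n = subst (_< i + + suc n) (ℤ.+-identityʳ i) (ℤ.+-monoʳ-< i (+<+ z<s))

  i≤∣i∣ : ∀ i → i ≤ + ∣ i ∣
  i≤∣i∣ (+ n)    = ℤ.≤-refl
  i≤∣i∣ -[1+ n ] = ℤ.-≤+

  i≤j+∣i-j∣ : ∀ i j → i ≤ j + + ∣ i - j ∣
  i≤j+∣i-j∣ i j = subst (_≤ j + + ∣ i - j ∣) (lemma i j) (ℤ.+-monoʳ-≤ j (i≤∣i∣ (i - j)))
    where
    lemma : ∀ i j → j + (i + - j) ≡ i
    lemma = solve-∀

  1≢2*i : ∀ i → 1ℤ ≢ + 2 * i
  1≢2*i i eq = odd ∣ i ∣ (trans (cong ∣_∣ eq) (ℤ.abs-* (+ 2) i))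
    where
    odd : ∀ m → 1 ≢ 2 ℕ.* m
    odd (suc m) eq with trans eq (cong suc (ℕ.+-suc m (m ℕ.+ 0)))
    ... | ()

  2*i≡0⇒i≡0 : ∀ i → + 2 * i ≡ 0ℤ → i ≡ 0ℤ
  2*i≡0⇒i≡0 i eq with ℤ.i*j≡0⇒i≡0∨j≡0 (+ 2) eq
  ... | inj₂ i≡0 = i≡0

  DarkAbove : ℤ → (ℤ → ℤ) → Set
  DarkAbove b p = ∀ i → b < i → p i ≡ 0ℤ

  -- The wreath product ℤ ≀ ℤ, except that supports need only be bounded above:
  -- (p , k) stands for the pair of the Laurent series Σ p(i) tⁱ and tᵏ.
  record Wreath : Set where
    field
      lamp  : ℤ → ℤ
      pos   : ℤ
      bound : ℤ
      dark  : DarkAbove bound lamp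

  open Wreath

  _≈ʷ_ : Wreath → Wreath → Set
  a ≈ʷ b = (∀ i → lamp a i ≡ lamp b i) × pos a ≡ pos b

  _∙ʷ_ : Wreath → Wreath → Wreath
  a ∙ʷ b = record
    { lamp  = λ i → lamp a i + lamp b (i - pos a)
    ; pos   = pos a + pos b
    ; bound = bound a ℤ.⊔ (bound b + pos a)
    ; dark  = λ i lt → cong₂ _+_
        (dark a i (ℤ.≤-<-trans (ℤ.i≤i⊔j (bound a) _) lt))
        (dark b (i - pos a) (subst (_< i - pos a) (cancel (bound b) (pos a))
          (ℤ.+-monoˡ-< (- pos a) (ℤ.≤-<-trans (ℤ.i≤j⊔i (bound a) _) lt))))
    }
    where
    cancel : ∀ b k → b + k + - k ≡ b
    cancel = solve-∀

  εʷ : Wreath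
  εʷ = record { lamp = λ _ → 0ℤ ; pos = 0ℤ ; bound = 0ℤ ; dark = λ _ _ → refl }

  _⁻¹ʷ : Wreath → Wreath
  a ⁻¹ʷ = record
    { lamp  = λ i → - lamp a (i + pos a)
    ; pos   = - pos a
    ; bound = bound a - pos a
    ; dark  = λ i lt → cong -_ (dark a (i + pos a)
        (subst (_< i + pos a) (cancel (bound a) (pos a)) (ℤ.+-monoˡ-< (pos a) lt)))
    }
    where
    cancel : ∀ b k → b + - k + k ≡ b
    cancel = solve-∀

  wreathGroup : Group 0ℓ 0ℓ
  wreathGroup = record
    { Carrier = Wreath
    ; _≈_ = _≈ʷ_
    ; _∙_ = _∙ʷ_
    ; ε = εʷ
    ; _⁻¹ = _⁻¹ʷ
    ; isGroup = record
      { isMonoid = record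
        { isSemigroup = record
          { isMagma = record
            { isEquivalence = record
              { refl = (λ _ → refl) , refl
              ; sym = λ (p , q) → (λ i → sym (p i)) , sym q
              ; trans = λ (p , q) (p′ , q′) → (λ i → trans (p i) (p′ i)) , trans q q′
              }
            ; ∙-cong = λ { (p , refl) (q , refl) → (λ i → cong₂ _+_ (p i) (q _)) , refl }
            }
          ; assoc = λ a b c →
              (λ i → trans (ℤ.+-assoc (lamp a i) _ _)
                (cong (λ j → lamp a i + (lamp b (i - pos a) + lamp c j)) (shift i (pos a) (pos b))))
              , ℤ.+-assoc (pos a) (pos b) (pos c)
          }
        ; identity =
            (λ a → (λ i → trans (ℤ.+-identityˡ _) (cong (lamp a) (ℤ.+-identityʳ i))) , ℤ.+-identityˡ _)
          , (λ a → (λ i → ℤ.+-identityʳ _) , ℤ.+-identityʳ _)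
        }
      ; inverse =
          (λ a → (λ i → trans (cong (λ j → - lamp a (i + pos a) + lamp a j) (unneg i (pos a)))
                              (ℤ.+-inverseˡ (lamp a (i + pos a))))
                 , ℤ.+-inverseˡ (pos a))
        , (λ a → (λ i → trans (cong (λ j → lamp a i + - lamp a j) (cancel i (pos a)))
                              (ℤ.+-inverseʳ (lamp a i)))
                 , ℤ.+-inverseʳ (pos a))
      ; ⁻¹-cong = λ { (p , refl) → (λ i → cong -_ (p _)) , refl }
      }
    }
    where
    shift : ∀ i k l → i + - (k + l) ≡ i + - k + - l
    shift = solve-∀
    unneg : ∀ i k → i + - - k ≡ i + k
    unneg = solve-∀
    cancel : ∀ i k → i + - k + k ≡ i
    cancel = solve-∀

  δ : ℤ → ℤ
  δ (+ zero)  = 1ℤ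
  δ (+ suc _) = 0ℤ
  δ -[1+ _ ]  = 0ℤ

  step lit : Wreath
  step = record { lamp = λ _ → 0ℤ ; pos = 1ℤ ; bound = 0ℤ ; dark = λ _ _ → refl }
  lit  = record { lamp = δ ; pos = 0ℤ ; bound = 0ℤ ; dark = λ { (+ suc _) _ → refl ; (+ zero) (+<+ ()) } }

  -- Commuting with the shift makes the lamps translation invariant, and far to the right they are
  -- all off.
  step-commuting⇒unlit : ∀ z → (z ∙ʷ step) ≈ʷ (step ∙ʷ z) → ∀ i → lamp z i ≡ 0ℤ
  step-commuting⇒unlit z (comm , _) i =
    trans (invariant (suc ∣ bound z - i ∣)) (dark z _ (ℤ.≤-<-trans (i≤j+∣i-j∣ (bound z) i) far))
    where
    far : i + + ∣ bound z - i ∣ < i + + suc ∣ bound z - i ∣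
    far = ℤ.+-monoʳ-< i (+<+ (ℕ.n<1+n _))
    pred : ∀ j → j + 1ℤ + - 1ℤ ≡ j
    pred = solve-∀
    invariant₁ : ∀ j → lamp z j ≡ lamp z (j + 1ℤ)
    invariant₁ j = begin
      lamp z j                 ≡⟨ cong (lamp z) (pred j) ⟨
      lamp z (j + 1ℤ + - 1ℤ)   ≡⟨ ℤ.+-identityˡ _ ⟨
      lamp (step ∙ʷ z) (j + 1ℤ) ≡⟨ comm (j + 1ℤ) ⟨
      lamp z (j + 1ℤ) + 0ℤ     ≡⟨ ℤ.+-identityʳ _ ⟩
      lamp z (j + 1ℤ)          ∎
      where open ≡-Reasoning
    invariant : ∀ m → lamp z i ≡ lamp z (i + + m)
    invariant zero    = cong (lamp z) (sym (ℤ.+-identityʳ i))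
    invariant (suc m) = trans (invariant m) (trans (invariant₁ (i + + m)) (cong (lamp z)
      (trans (ℤ.+-assoc i (+ m) 1ℤ) (cong (λ n → i + + n) (ℕ.+-comm m 1)))))

  -- Once `z` is unlit, commuting with a single lamp forbids any displacement. This disposes of the
  -- ambiguity of a conjugator that is known only through its effect on the two generators.
  centralizer-trivial : ∀ z → (z ∙ʷ step) ≈ʷ (step ∙ʷ z) → (z ∙ʷ lit) ≈ʷ (lit ∙ʷ z) → z ≈ʷ εʷ
  centralizer-trivial z comm-step (comm-lit , _) = unlit , δ≡1⇒≡0 (pos z) δ[-pos]≡1
    where
    unlit : ∀ i → lamp z i ≡ 0ℤ
    unlit = step-commuting⇒unlit z comm-step
    δ[-pos]≡1 : δ (0ℤ - pos z) ≡ 1ℤ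
    δ[-pos]≡1 = begin
      δ (0ℤ - pos z)                 ≡⟨ ℤ.+-identityˡ _ ⟨
      0ℤ + δ (0ℤ - pos z)            ≡⟨ cong (_+ δ (0ℤ - pos z)) (unlit 0ℤ) ⟨
      lamp z 0ℤ + δ (0ℤ - pos z)     ≡⟨ comm-lit 0ℤ ⟩
      1ℤ + lamp z 0ℤ                 ≡⟨ cong (λ a → 1ℤ + a) (unlit 0ℤ) ⟩
      1ℤ                             ∎
      where open ≡-Reasoning
    δ≡1⇒≡0 : ∀ k → δ (0ℤ - k) ≡ 1ℤ → k ≡ 0ℤ
    δ≡1⇒≡0 (+ zero) _ = refl

  -- Multiplication by t - 1 on Laurent series; `twisted p n` below is the product of p with 1 + 2(t
  -- - 1)(1 - tⁿ).
  Δ : (ℤ → ℤ) → ℤ → ℤ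
  Δ p i = p (i - 1ℤ) - p i

  twisted : (ℤ → ℤ) → ℤ → ℤ → ℤ
  twisted p n i = p i + + 2 * Δ p i - + 2 * Δ p (i - n)

  -- A search downwards from the bound `l + d`; it stops at `l` at the latest, since `p` is lit
  -- there.
  brightest : ∀ (p : ℤ → ℤ) d l → p l ≢ 0ℤ → DarkAbove (l + + d) p →
    ∃ λ m → l ≤ m × p m ≢ 0ℤ × DarkAbove m p
  brightest p zero    l lit-l dark = l , ℤ.≤-refl , lit-l , subst (λ b → DarkAbove b p) (ℤ.+-identityʳ l) dark
  brightest p (suc d) l lit-l dark with p (l + + suc d) ℤ.≟ 0ℤ
  ... | no lit-top  = l + + suc d , ℤ.<⇒≤ (i<i+1+n l d) , lit-top , dark
  ... | yes off-top = brightest p d l lit-l λ i lt → [ dark i , (λ { refl → off-top }) ]′ (split i lt)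
    where
    next : ℤ.suc (l + + d) ≡ l + + suc d
    next = trans (ℤ.+-comm 1ℤ (l + + d)) (trans (ℤ.+-assoc l (+ d) 1ℤ) (cong (λ n → l + + n) (ℕ.+-comm d 1)))
    split : ∀ i → l + + d < i → (l + + suc d < i) ⊎ (l + + suc d ≡ i)
    split i lt with l + + suc d ℤ.≟ i
    ... | yes eq = inj₂ eq
    ... | no neq = inj₁ (ℤ.≤∧≢⇒< (subst (_≤ i) next (ℤ.i<j⇒suc[i]≤j lt)) neq)

  -- Modulo 2 the twist does nothing, so p is lit at l; over ℤ it strictly raises
  -- the top degree, so the result is lit somewhere beyond l.
  twisted-noOddTop : ∀ p b n l → DarkAbove b p → n ≢ 0ℤ →
    twisted p n l ≡ 1ℤ → ¬ DarkAbove l (twisted p n)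
  twisted-noOddTop p b n l dark n≢0 top≡1 darkAbove
    with brightest p ∣ b - l ∣ l lit-l (λ i lt → dark i (ℤ.≤-<-trans (i≤j+∣i-j∣ b l) lt))
    where
    lit-l : p l ≢ 0ℤ
    lit-l off = 1≢2*i (Δ p l + - Δ p (l - n)) (trans (sym top≡1)
      (trans (cong (λ a → a + + 2 * Δ p l - + 2 * Δ p (l - n)) off) (factor (Δ p l) (Δ p (l - n)))))
      where
      factor : ∀ a b → 0ℤ + + 2 * a + - (+ 2 * b) ≡ + 2 * (a + - b)
      factor = solve-∀
  ... | m , l≤m , lit-m , dark-m = go n n≢0 darkAbove
    where
    Δ-dark : ∀ i → m < i - 1ℤ → Δ p i ≡ 0ℤ
    Δ-dark i lt = cong₂ _-_ (dark-m (i - 1ℤ) lt)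
      (dark-m i (ℤ.<-trans lt (subst (i - 1ℤ <_) (pred i) (i<i+1+n (i - 1ℤ) 0))))
      where
      pred : ∀ i → i + - 1ℤ + 1ℤ ≡ i
      pred = solve-∀
    Δ-top : ∀ i → i ≡ m + 1ℤ → Δ p i ≡ p m
    Δ-top _ refl = trans (cong₂ _-_ (cong p (pred m)) (dark-m _ (i<i+1+n m 0))) (ℤ.+-identityʳ _)
      where
      pred : ∀ m → m + 1ℤ + - 1ℤ ≡ m
      pred = solve-∀
    go : ∀ n → n ≢ 0ℤ → ¬ DarkAbove l (twisted p n)
    -- The multiplier 1 + 2(t - 1)(1 - tᴺ) has leading term -2tᴺ⁺¹ for N > 0 and 2t for N < 0.
    -- Evaluating at degree m + N + 1 or m + 1 respectively isolates ∓2p(m), which is not zero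
    -- although it lies above `l`.
    go (+ zero)  n≢0 = contradiction refl n≢0
    go (+ suc n) _ darkAbove = lit-m (2*i≡0⇒i≡0 (p m) (ℤ.neg-injective (trans (sym value) (darkAbove t l<t))))
      where
      t : ℤ
      t = m + + suc n + 1ℤ
      shift₁ : ∀ m a → m + a + 1ℤ + - 1ℤ ≡ m + a
      shift₁ = solve-∀
      shift₂ : ∀ m a → m + a + 1ℤ + - a ≡ m + 1ℤ
      shift₂ = solve-∀
      m<t : m < t
      m<t = ℤ.<-trans (i<i+1+n m n) (i<i+1+n _ 0)
      l<t : l < t
      l<t = ℤ.≤-<-trans l≤m m<t
      value : twisted p (+ suc n) t ≡ - (+ 2 * p m)
      value = trans (cong₂ (λ a b → a - + 2 * b)
        (cong₂ (λ a b → a + + 2 * b) (dark-m t m<t)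
          (Δ-dark t (subst (m <_) (sym (shift₁ m (+ suc n))) (i<i+1+n m n))))
        (Δ-top (t - + suc n) (shift₂ m (+ suc n)))) (ℤ.+-identityˡ _)
    go -[1+ n ] _ darkAbove = lit-m (2*i≡0⇒i≡0 (p m) (trans (sym value) (darkAbove t l<t)))
      where
      t : ℤ
      t = m + 1ℤ
      shift : ∀ m a → m + 1ℤ + a + - 1ℤ ≡ m + a
      shift = solve-∀
      m<t : m < t
      m<t = i<i+1+n m 0
      l<t : l < t
      l<t = ℤ.≤-<-trans l≤m m<t
      value : twisted p -[1+ n ] t ≡ + 2 * p m
      value = trans (cong₂ (λ a b → a - + 2 * b)
        (cong₂ (λ a b → a + + 2 * b) (dark-m t m<t) (Δ-top t refl))
        (Δ-dark (t - -[1+ n ]) (subst (m <_) (sym (shift m (+ suc n))) (i<i+1+n m n))))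
        (unit (p m))
        where
        unit : ∀ a → 0ℤ + + 2 * a + - (+ 2 * 0ℤ) ≡ + 2 * a
        unit = solve-∀

  open Twist wreathGroup using () renaming (u to uʷ; twist to twistʷ)

  uʷ-lamp : ∀ g i → lamp (uʷ step g) i ≡ + 2 * Δ (lamp g) (i + pos g)
  uʷ-lamp g i = begin
    lamp v i + lamp v (i - pos v)     ≡⟨ cong (λ j → lamp v i + lamp v j) (trans (cong (λ k → i - k) pos-v) (ℤ.+-identityʳ i)) ⟩
    lamp v i + lamp v i               ≡⟨ cong₂ _+_ (lamp-v i) (lamp-v i) ⟩
    d + d                             ≡⟨ double d ⟩
    + 2 * d                           ∎
    where
    open ≡-Reasoning
    d : ℤ
    d = Δ (lamp g) (i + pos g)
    v : Wreath
    v = (g ⁻¹ʷ) ∙ʷ (step ∙ʷ (g ∙ʷ (step ⁻¹ʷ)))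
    pos-v : pos v ≡ 0ℤ
    pos-v = lemma (pos g)
      where
      lemma : ∀ k → - k + (1ℤ + (k + - 1ℤ)) ≡ 0ℤ
      lemma = solve-∀
    double : ∀ a → a + a ≡ + 2 * a
    double = solve-∀
    lamp-v : ∀ i → lamp v i ≡ Δ (lamp g) (i + pos g)
    lamp-v i = trans (cong (λ j → - lamp g (i + pos g) + (0ℤ + (lamp g j + 0ℤ))) (index i (pos g)))
      (arrange (lamp g (i + pos g)) (lamp g (i + pos g - 1ℤ)))
      where
      index : ∀ i k → i + - - k + - 1ℤ ≡ i + k + - 1ℤ
      index = solve-∀
      arrange : ∀ a b → - a + (0ℤ + (b + 0ℤ)) ≡ b + - a
      arrange = solve-∀

  uʷ-pos : ∀ g → pos (uʷ step g) ≡ 0ℤ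
  uʷ-pos g = lemma (pos g)
    where
    lemma : ∀ k → (- k + (1ℤ + (k + - 1ℤ))) + (- k + (1ℤ + (k + - 1ℤ))) ≡ 0ℤ
    lemma = solve-∀

  -- As `u` has position 0 and `s` is unlit, u s u⁻¹ has the lamps of `u` minus their translates by
  -- `pos s`. Multiplying by `g` on the left shifts them by `pos g`, which undoes the shift in
  -- `uʷ-lamp`.
  twistʷ-lamp : ∀ g s → (∀ i → lamp s i ≡ 0ℤ) → ∀ i →
    lamp (twistʷ step g s) i ≡ twisted (lamp g) (pos s) i
  twistʷ-lamp g s unlit i = begin
    lamp g i + (lamp w (i - k) + (lamp s (i - k - pos w) + - lamp w (i - k - pos w - n + pos w)))
      ≡⟨ cong (λ o → lamp g i + (lamp w (i - k) + (lamp s (i - k - pos w) + - lamp w (i - k - o - n + o)))) (uʷ-pos g) ⟩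
    lamp g i + (lamp w (i - k) + (lamp s (i - k - pos w) + - lamp w (i - k - 0ℤ - n + 0ℤ)))
      ≡⟨ cong (λ o → lamp g i + (lamp w (i - k) + (o + - lamp w (i - k - 0ℤ - n + 0ℤ)))) (unlit _) ⟩
    lamp g i + (lamp w (i - k) + (0ℤ + - lamp w (i - k - 0ℤ - n + 0ℤ)))
      ≡⟨ cong₂ (λ a b → lamp g i + (a + (0ℤ + - b))) (at (i - k) i (index₁ i k)) (at (i - k - 0ℤ - n + 0ℤ) (i - n) (index₂ i k n)) ⟩
    lamp g i + (+ 2 * Δ (lamp g) i + (0ℤ + - (+ 2 * Δ (lamp g) (i - n))))
      ≡⟨ arrange (lamp g i) (+ 2 * Δ (lamp g) i) (+ 2 * Δ (lamp g) (i - n)) ⟩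
    twisted (lamp g) n i ∎
    where
    open ≡-Reasoning
    k n : ℤ
    k = pos g
    n = pos s
    w : Wreath
    w = uʷ step g
    at : ∀ j j′ → j + k ≡ j′ → lamp w j ≡ + 2 * Δ (lamp g) j′
    at j _ refl = uʷ-lamp g j
    index₁ : ∀ i k → i + - k + k ≡ i
    index₁ = solve-∀
    index₂ : ∀ i k n → i + - k + - 0ℤ + - n + 0ℤ + k ≡ i + - n
    index₂ = solve-∀
    arrange : ∀ a b c → a + (b + (0ℤ + - c)) ≡ a + b + - c
    arrange = solve-∀

-- Boolean combinations of equations and excluded middle

open Lamplighter
open import Data.Nat using (_≤_; _<_; _⊔_)

infix 4 _⟺_

_⟺_ : Set → Set → Set
P ⟺ Q = (P → Q) × (Q → P)

atoms : ∀ {k} {P : Formula k → Set₁} {φ} → BoolComb P φ → List (Σ (Formula k) P)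
atoms (atom {φ} p) = (φ , p) ∷ []
atoms (neg c)      = atoms c
atoms (conj c d)   = atoms c List.++ atoms d
atoms (disj c d)   = atoms c List.++ atoms d

boolComb-determined : ∀ (M : Structure) {k} {P : Formula k → Set₁} {φ} (c : BoolComb P φ) {ρ ρ′} →
  All (λ a → Sat M (proj₁ a) ρ ⟺ Sat M (proj₁ a) ρ′) (atoms c) → Sat M φ ρ ⟺ Sat M φ ρ′
boolComb-determined M (atom p) (e ∷ []) = e
boolComb-determined M (neg c) es =
  let f , g = boolComb-determined M c es in (λ ¬p → ¬p ∘ g) , (λ ¬p → ¬p ∘ f)
boolComb-determined M (conj c d) es =
  let f , g = boolComb-determined M c (All.++⁻ˡ (atoms c) es)
      h , k = boolComb-determined M d (All.++⁻ʳ (atoms c) es)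
  in Product.map f h , Product.map g k
boolComb-determined M (disj c d) es =
  let f , g = boolComb-determined M c (All.++⁻ˡ (atoms c) es)
      h , k = boolComb-determined M d (All.++⁻ʳ (atoms c) es)
  in Sum.map f h , Sum.map g k

module _ {T : Theory} {M : Structure} (M⊨T : Model T M) {n m : ℕ} where

  -- A subsingleton family {φ(x,b)}_{p : P}: a finite subfamily equivalent to
  -- it is either nonempty, so that P holds, or empty, so that P fails.
  refutableEquation⇒EM : ∀ φ → IsEquation T n m φ → ∀ a b →
    ¬ Sat M φ (a ++ b) → ExcludedMiddle 0ℓ
  refutableEquation⇒EM φ eqn a b ¬φ {P} with eqn M M⊨T P (λ _ → b)
  ... | []    , f = no (λ p → ¬φ (f a [] p))
  ... | p ∷ _ , _ = yes p

  -- Without excluded middle no instance of an equation can be refuted, so each atom is irrefutable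
  -- everywhere; the connectives preserve being constantly irrefutable or constantly false.
  boolComb-constant : ∀ {ψ} → ¬ ExcludedMiddle 0ℓ → BoolComb (IsEquation T n m) ψ →
    (∀ a b → ¬ ¬ Sat M ψ (a ++ b)) ⊎ (∀ a b → ¬ Sat M ψ (a ++ b))
  boolComb-constant ¬em (atom {φ} eqn) = inj₁ λ a b ¬φ → ¬em (refutableEquation⇒EM φ eqn a b ¬φ)
  boolComb-constant ¬em (neg c) with boolComb-constant ¬em c
  ... | inj₁ t = inj₂ t
  ... | inj₂ f = inj₁ λ a b ¬¬ψ → ¬¬ψ (f a b)
  boolComb-constant ¬em (conj c d) with boolComb-constant ¬em c | boolComb-constant ¬em d
  ... | inj₁ t | inj₁ t′ = inj₁ λ a b ¬ψ → t a b λ p → t′ a b λ q → ¬ψ (p , q)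
  ... | inj₂ f | _       = inj₂ λ a b → f a b ∘ proj₁
  ... | _      | inj₂ f  = inj₂ λ a b → f a b ∘ proj₂
  boolComb-constant ¬em (disj c d) with boolComb-constant ¬em c | boolComb-constant ¬em d
  ... | inj₂ f | inj₂ f′ = inj₂ λ a b → [ f a b , f′ a b ]′
  ... | inj₁ t | _       = inj₁ λ a b ¬ψ → t a b (¬ψ ∘ inj₁)
  ... | _      | inj₁ t  = inj₁ λ a b ¬ψ → t a b (¬ψ ∘ inj₂)

-- The formula x = y is not constant: it fails at (a,b) and holds at (a,a), and so does any formula
-- equivalent to it.
equational⇒¬¬EM : ∀ {T M} → Model T M → ∀ {a b} → ¬ Structure._≈_ M a b →
  Equational T → ¬ ¬ ExcludedMiddle 0ℓ
equational⇒¬¬EM {T} {M} M⊨T {a} {b} a≉b equational ¬em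
  with equational 1 1 (var zero ≐ var (suc zero))
... | ψ , c , equiv = [ (λ t → t (λ _ → a) (λ _ → b) (a≉b ∘ proj₂ (equiv M M⊨T _)))
                      , (λ f → f (λ _ → a) (λ _ → a) (proj₁ (equiv M M⊨T _) (Structure.≈-refl M)))
                      ]′ (boolComb-constant M⊨T ¬em c)

-- Invariance of satisfaction under automorphisms

-- A relation in place of a map lets conjugation be stated as z a ≈ a′ z. Totality on both sides is
-- what the quantifiers use.
record Automorphism (M : Structure) : Set₁ where
  open Structure M
  field
    _~_    : Carrier → Carrier → Set
    ~-op   : ∀ {a a′ b b′} → a ~ a′ → b ~ b′ → op a b ~ op a′ b′
    ~-inv  : ∀ {a a′} → a ~ a′ → inv a ~ inv a′
    ~-unit : unit ~ unit
    ~-≈    : ∀ {a a′ b b′} → a ~ a′ → b ~ b′ → (a ≈ b) ⟺ (a′ ≈ b′)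
    to     : ∀ a → ∃ λ a′ → a ~ a′
    from   : ∀ a′ → ∃ λ a → a ~ a′

module _ {M : Structure} (α : Automorphism M) where
  open Automorphism α

  ~-extend : ∀ {n a a′} {ρ ρ′ : Fin n → Structure.Carrier M} → a ~ a′ → (∀ i → ρ i ~ ρ′ i) →
    ∀ i → extend a ρ i ~ extend a′ ρ′ i
  ~-extend r rs zero    = r
  ~-extend r rs (suc i) = rs i

  evalT-invariant : ∀ {n} (t : Term n) {ρ ρ′} → (∀ i → ρ i ~ ρ′ i) → evalT M t ρ ~ evalT M t ρ′
  evalT-invariant (var i)  r = r i
  evalT-invariant e'       r = ~-unit
  evalT-invariant (s ·' t) r = ~-op (evalT-invariant s r) (evalT-invariant t r)
  evalT-invariant (inv' t) r = ~-inv (evalT-invariant t r)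

  Sat-invariant : ∀ {n} (φ : Formula n) {ρ ρ′} → (∀ i → ρ i ~ ρ′ i) → Sat M φ ρ ⟺ Sat M φ ρ′
  Sat-invariant (s ≐ t)  r = ~-≈ (evalT-invariant s r) (evalT-invariant t r)
  Sat-invariant ⊤'       r = id , id
  Sat-invariant ⊥'       r = id , id
  Sat-invariant (¬' φ)   r = let f , g = Sat-invariant φ r in (_∘ g) , (_∘ f)
  Sat-invariant (φ ∧' ψ) r =
    let f , g = Sat-invariant φ r; h , k = Sat-invariant ψ r
    in Product.map f h , Product.map g k
  Sat-invariant (φ ∨' ψ) r =
    let f , g = Sat-invariant φ r; h , k = Sat-invariant ψ r
    in Sum.map f h , Sum.map g k
  Sat-invariant (φ ⇒' ψ) r =
    let f , g = Sat-invariant φ r; h , k = Sat-invariant ψ r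
    in (λ p → h ∘ p ∘ g) , (λ p → k ∘ p ∘ f)
  Sat-invariant (∀' φ) r =
      (λ p a′ → let a , s = from a′ in proj₁ (Sat-invariant φ (~-extend s r)) (p a))
    , (λ p a → let a′ , s = to a in proj₂ (Sat-invariant φ (~-extend s r)) (p a′))
  Sat-invariant (∃' φ) r =
      (λ (a , p) → let a′ , s = to a in a′ , proj₁ (Sat-invariant φ (~-extend s r)) p)
    , (λ (a′ , p) → let a , s = from a′ in a , proj₂ (Sat-invariant φ (~-extend s r)) p)

-- Infinite Ramsey theorem for pairs

StrictMono : (ℕ → ℕ) → Set
StrictMono f = ∀ {i j} → i < j → f i < f j

step-StrictMono : ∀ {f : ℕ → ℕ} → (∀ n → f n < f (suc n)) → StrictMono f
step-StrictMono step {i} {suc j} (s≤s i≤j) with ℕ.m≤n⇒m<n∨m≡n i≤j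
... | inj₁ i<j  = ℕ.<-trans (step-StrictMono step i<j) (step j)
... | inj₂ refl = step i

module Ramsey (em : ExcludedMiddle 0ℓ) where

  -- If `P` holds arbitrarily far out, its witnesses are picked one after another; otherwise some
  -- tail avoids `P`.
  infinite? : (P : ℕ → Set) →
    ∃ λ f → StrictMono f × ((∀ n → P (f n)) ⊎ (∀ n → ¬ P (f n)))
  infinite? P with em {∀ n → ∃ λ m → n ≤ m × P m}
  ... | yes pick = f , step-StrictMono (λ n → proj₁ (proj₂ (pick (suc (f n))))) , inj₁ Pf
    where
    f : ℕ → ℕ
    f zero    = proj₁ (pick 0)
    f (suc n) = proj₁ (pick (suc (f n)))
    Pf : ∀ n → P (f n)
    Pf zero    = proj₂ (proj₂ (pick 0))
    Pf (suc n) = proj₂ (proj₂ (pick (suc (f n))))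
  ... | no ¬pick with em {∃ λ n → ∀ m → n ≤ m → ¬ P m}
  ...   | yes (n , ¬P) = (n ℕ.+_) , ℕ.+-monoʳ-< n , inj₂ λ m → ¬P (n ℕ.+ m) (ℕ.m≤m+n n m)
  ...   | no ¬cofinite = contradiction pick ¬pick
    where
    pick : ∀ n → ∃ λ m → n ≤ m × P m
    pick n with em {∃ λ m → n ≤ m × P m}
    ... | yes p = p
    ... | no ¬p = contradiction (n , λ m n≤m Pm → ¬p (m , n≤m , Pm)) ¬cofinite

  module _ (R : ℕ → ℕ → Set) where

    record Stage : Set where
      field
        seq  : ℕ → ℕ
        mono : StrictMono seq

    open Stage

    -- The terms after the first are thinned until all of them have the same colour with the first.
    refine : (s : Stage) → ∃ λ (f : ℕ → ℕ) → StrictMono f ×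
      ((∀ n → R (seq s (suc (f n))) (seq s 0)) ⊎ (∀ n → ¬ R (seq s (suc (f n))) (seq s 0)))
    refine s = infinite? (λ n → R (seq s (suc n)) (seq s 0))

    next : Stage → Stage
    next s = record
      { seq  = λ n → seq s (suc (proj₁ (refine s) n))
      ; mono = λ i<j → mono s (s<s (proj₁ (proj₂ (refine s)) i<j))
      }

    stage : ℕ → Stage
    stage zero    = record { seq = id ; mono = id }
    stage (suc k) = next (stage k)

    pivot : ℕ → ℕ
    pivot k = seq (stage k) 0

    pivot-mono : StrictMono pivot
    pivot-mono = step-StrictMono λ k → mono (stage k) z<s

    -- Each stage is a subsequence of the one before, so its terms keep every property shared by an
    -- earlier stage.
    inherited : ∀ (P : ℕ → Set) k → (∀ n → P (seq (stage k) n)) →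
      ∀ l → k ≤ l → ∀ n → P (seq (stage l) n)
    inherited P k p zero    z≤n n = p n
    inherited P k p (suc l) k≤l n with ℕ.m≤n⇒m<n∨m≡n k≤l
    ... | inj₁ (s≤s k≤l′) = inherited P k p l k≤l′ _
    ... | inj₂ refl       = p n

    -- The colour of a pair of pivots depends only on the earlier pivot, because the later one
    -- belongs to the stage refined against it. One more selection makes the colours of the pivots
    -- equal.
    homogeneous : ∃ λ f → StrictMono f ×
      ((∀ {i j} → j < i → R (f i) (f j)) ⊎ (∀ {i j} → j < i → ¬ R (f i) (f j)))
    homogeneous with infinite? (λ k → ∀ n → R (seq (stage (suc k)) n) (pivot k))
    ... | f , f-mono , inj₁ red = pivot ∘ f , (λ i<j → pivot-mono (f-mono i<j)) , inj₁ λ {i} {j} j<i →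
          inherited (λ m → R m (pivot (f j))) (suc (f j)) (red j) (f i) (f-mono j<i) 0
    ... | f , f-mono , inj₂ ¬red = pivot ∘ f , (λ i<j → pivot-mono (f-mono i<j)) , inj₂ λ {i} {j} j<i →
          inherited (λ m → ¬ R m (pivot (f j))) (suc (f j)) (blue j) (f i) (f-mono j<i) 0
      where
      blue : ∀ j n → ¬ R (seq (stage (suc (f j))) n) (pivot (f j))
      -- A refined stage is never mixed, so one that is not wholly red is wholly blue.
      blue j with proj₂ (proj₂ (refine (stage (f j))))
      ... | inj₁ r = contradiction r (¬red j)
      ... | inj₂ b = b

-- Closed sets and the infinite descent

module Descent (em : ExcludedMiddle 0ℓ) (G : Group 0ℓ 0ℓ) where
  open Group G using (Carrier; _≈_; _∙_; _⁻¹; ε)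
  open Ramsey em

  Closed : (Carrier → Set) → Set
  Closed S = ∀ (x y : ℕ → Carrier) g → (∀ k → x k ⁻¹ ∙ y k ≈ g) →
    (∀ {i j} → j < i → S (x i ⁻¹ ∙ y j)) → S g

  -- For each g only the sequence that reverses the truth value at g is asked for.
  Alternating : (Carrier → Set) → Set
  Alternating D = ∀ g → ∃ λ (x : ℕ → Carrier) → ∃ λ (y : ℕ → Carrier) →
    (∀ k → x k ⁻¹ ∙ y k ≈ g) ×
    (∀ {i j} → j < i → (D g → ¬ D (x i ⁻¹ ∙ y j)) × (¬ D g → D (x i ⁻¹ ∙ y j)))

  count : List (Carrier → Set) → Carrier → ℕ
  count []       g = 0
  count (S ∷ Ss) g with em {S g}
  ... | yes _ = suc (count Ss g)
  ... | no  _ = count Ss g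

  -- For the descent `h` is an off-diagonal value and `g` the diagonal one: either the count drops,
  -- or no listed set separates the two.
  count-mono : ∀ Ss {g h} → All (λ S → S h → S g) Ss →
    count Ss h < count Ss g ⊎ (count Ss h ≡ count Ss g × All (λ S → S h ⟺ S g) Ss)
  count-mono [] [] = inj₂ (refl , [])
  count-mono (S ∷ Ss) {g} {h} (f ∷ fs) with em {S h} | em {S g} | count-mono Ss fs
  ... | yes _ | yes _ | inj₁ lt       = inj₁ (s≤s lt)
  ... | yes p | yes q | inj₂ (eq , e) = inj₂ (cong suc eq , ((λ _ → q) , (λ _ → p)) ∷ e)
  ... | yes p | no ¬q | _             = contradiction (f p) ¬q
  ... | no _  | yes _ | inj₁ lt       = inj₁ (ℕ.m<n⇒m<1+n lt)
  ... | no _  | yes _ | inj₂ (eq , _) = inj₁ (s≤s (ℕ.≤-reflexive eq))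
  ... | no _  | no _  | inj₁ lt       = inj₁ lt
  ... | no ¬p | no ¬q | inj₂ (eq , e) =
        inj₂ (eq , ((λ p → contradiction p ¬p) , (λ q → contradiction q ¬q)) ∷ e)

  module _ (x y : ℕ → Carrier) (g : Carrier) (diag : ∀ k → x k ⁻¹ ∙ y k ≈ g) where

    Reflects : (Carrier → Set) → (ℕ → ℕ) → Set
    Reflects S f = ∀ {i j} → j < i → S (x (f i) ⁻¹ ∙ y (f j)) → S g

    -- On a homogeneous subsequence the off-diagonal values all lie in `S`, and closedness gives
    -- `S g`, or they all avoid `S`, and the implication is vacuous.
    reflecting : ∀ S → Closed S → ∀ f → ∃ λ h → StrictMono h × Reflects S (f ∘ h)
    reflecting S closed f with homogeneous (λ i j → S (x (f i) ⁻¹ ∙ y (f j)))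
    ... | h , h-mono , inj₁ all  = h , h-mono , λ _ _ → closed (x ∘ f ∘ h) (y ∘ f ∘ h) g (λ k → diag _) all
    ... | h , h-mono , inj₂ none = h , h-mono , λ j<i s → contradiction s (none j<i)

    reflecting-all : ∀ Ss → All Closed Ss → ∀ f → StrictMono f →
      ∃ λ h → StrictMono h × All (λ S → Reflects S h) Ss
    reflecting-all [] [] f f-mono = f , f-mono , []
    reflecting-all (S ∷ Ss) (c ∷ cs) f f-mono =
      let h , h-mono , rs = reflecting-all Ss cs f f-mono
          k , k-mono , r  = reflecting S c h
      in h ∘ k , (λ i<j → h-mono (k-mono i<j)) , r ∷ All.map (λ r′ {i} {j} j<i → r′ (k-mono j<i)) rs

  alternating-¬boolComb : ∀ {Ss} {D : Carrier → Set} → All Closed Ss →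
    (∀ g h → All (λ S → S h ⟺ S g) Ss → D h ⟺ D g) → ¬ Alternating D
  alternating-¬boolComb {Ss} {D} closed determined alt = descend (count Ss ε) ε ℕ.≤-refl
    where
    descend : ∀ n g → count Ss g ≤ n → ⊥
    descend n g le with alt g
    ... | x , y , diag , off with reflecting-all x y g diag Ss closed id id
    ...   | h , h-mono , refl-all = go (count-mono Ss (All.map (λ r → r z<s) refl-all)) n le
      where
      g′ : Carrier
      g′ = x (h 1) ⁻¹ ∙ y (h 0)
      go : count Ss g′ < count Ss g ⊎ (count Ss g′ ≡ count Ss g × All (λ S → S g′ ⟺ S g) Ss) →
        ∀ n → count Ss g ≤ n → ⊥
      go (inj₁ lt) zero    le = ℕ.n≮0 (ℕ.<-≤-trans lt le)
      go (inj₁ lt) (suc n) le = descend n g′ (ℕ.≤-pred (ℕ.<-≤-trans lt le))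
      -- Equal counts put `g′` and `g` in the same closed sets, so `D` agrees on them, whereas `off`
      -- reverses it. Hence `D g` refutes itself, and its negation yields it.
      go (inj₂ (_ , agree)) _ _ with determined g g′ agree | off (h-mono z<s)
      ... | to , from | flip⁻ , flip⁺ =
        let ¬Dg = λ p → flip⁻ p (from p) in ¬Dg (to (flip⁺ ¬Dg))

-- Commutation, homomorphisms and conjugation

Commute : (G : Group 0ℓ 0ℓ) → Group.Carrier G → Group.Carrier G → Set
Commute G a b = a ∙ b ≈ b ∙ a
  where open Group G

module _ (G H : Group 0ℓ 0ℓ) where
  private
    module G = Group G
    module H = Group H
  open GroupMorphisms G.rawGroup H.rawGroup using (IsGroupHomomorphism)

  groupHom : (f : G.Carrier → H.Carrier) → (∀ {a b} → a G.≈ b → f a H.≈ f b) →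
    (∀ a b → f (a G.∙ b) H.≈ f a H.∙ f b) → IsGroupHom G H f
  groupHom f f-cong f-homo = record
    { isMonoidHomomorphism = record
      { isMagmaHomomorphism = record
        { isRelHomomorphism = record { cong = f-cong }
        ; homo = f-homo
        }
      ; ε-homo = f-ε
      }
    ; ⁻¹-homo = λ a → inverseˡ-unique (f (a G.⁻¹)) (f a)
        (H.trans (H.sym (f-homo _ _)) (H.trans (f-cong (G.inverseˡ a)) f-ε))
    }
    where
    open GroupProperties H using (inverseˡ-unique; identityˡ-unique)
    f-ε : f G.ε H.≈ H.ε
    f-ε = identityˡ-unique (f G.ε) (f G.ε)
      (H.trans (H.sym (f-homo _ _)) (f-cong (G.identityˡ G.ε)))

  module _ {f : G.Carrier → H.Carrier} (f-hom : IsGroupHom G H f) where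
    open IsGroupHomomorphism f-hom

    hom-Commute : ∀ {a b} → Commute G a b → Commute H (f a) (f b)
    hom-Commute ab≈ba = H.trans (H.sym (homo _ _)) (H.trans (⟦⟧-cong ab≈ba) (homo _ _))

module _ (G : Group 0ℓ 0ℓ) where
  open Group G
  open GroupProperties G
  open SetoidReasoning setoid

  conjugate : Carrier → Carrier → Carrier
  conjugate z a = z ∙ (a ∙ z ⁻¹)

  conjugate-hom : ∀ z → IsGroupHom G G (conjugate z)
  conjugate-hom z = groupHom G G (conjugate z) (∙-congˡ ∘ ∙-congʳ) λ a b → begin
    z ∙ (a ∙ b ∙ z ⁻¹)                     ≈⟨ ∙-congˡ (assoc a b (z ⁻¹)) ⟩
    z ∙ (a ∙ (b ∙ z ⁻¹))                   ≈⟨ ∙-congˡ (∙-congˡ (\\-leftDividesʳ z (b ∙ z ⁻¹))) ⟨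
    z ∙ (a ∙ (z ⁻¹ ∙ (z ∙ (b ∙ z ⁻¹))))    ≈⟨ ∙-congˡ (assoc a (z ⁻¹) _) ⟨
    z ∙ (a ∙ z ⁻¹ ∙ (z ∙ (b ∙ z ⁻¹)))      ≈⟨ assoc z (a ∙ z ⁻¹) _ ⟨
    z ∙ (a ∙ z ⁻¹) ∙ (z ∙ (b ∙ z ⁻¹))      ∎

  Commute⇒conjugate : ∀ {z a} → Commute G z a → conjugate z a ≈ a
  Commute⇒conjugate {z} {a} za≈az = begin
    z ∙ (a ∙ z ⁻¹) ≈⟨ assoc z a (z ⁻¹) ⟨
    z ∙ a ∙ z ⁻¹   ≈⟨ ∙-congʳ za≈az ⟩
    a ∙ z ∙ z ⁻¹   ≈⟨ //-rightDividesʳ z a ⟩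
    a              ∎

  conjugate⇒Commute : ∀ {z a} → conjugate z a ≈ a → Commute G z a
  conjugate⇒Commute {z} {a} eq = begin
    z ∙ a                  ≈⟨ ∙-congˡ (//-rightDividesˡ z a) ⟨
    z ∙ (a ∙ z ⁻¹ ∙ z)     ≈⟨ assoc z (a ∙ z ⁻¹) z ⟨
    z ∙ (a ∙ z ⁻¹) ∙ z     ≈⟨ ∙-congʳ eq ⟩
    a ∙ z                  ∎

  Commute-∙ : ∀ {a b z} → Commute G a z → Commute G b z → Commute G (a ∙ b) z
  Commute-∙ {a} {b} {z} az≈za bz≈zb = begin
    a ∙ b ∙ z   ≈⟨ assoc a b z ⟩
    a ∙ (b ∙ z) ≈⟨ ∙-congˡ bz≈zb ⟩
    a ∙ (z ∙ b) ≈⟨ assoc a z b ⟨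
    a ∙ z ∙ b   ≈⟨ ∙-congʳ az≈za ⟩
    z ∙ a ∙ b   ≈⟨ assoc z a b ⟩
    z ∙ (a ∙ b) ∎

  Commute-⁻¹ : ∀ {a z} → Commute G a z → Commute G (a ⁻¹) z
  Commute-⁻¹ {a} {z} az≈za = begin
    a ⁻¹ ∙ z               ≈⟨ ∙-congˡ (//-rightDividesʳ a z) ⟨
    a ⁻¹ ∙ (z ∙ a ∙ a ⁻¹)  ≈⟨ ∙-congˡ (∙-congʳ az≈za) ⟨
    a ⁻¹ ∙ (a ∙ z ∙ a ⁻¹)  ≈⟨ ∙-congˡ (assoc a z (a ⁻¹)) ⟩
    a ⁻¹ ∙ (a ∙ (z ∙ a ⁻¹)) ≈⟨ \\-leftDividesʳ a (z ∙ a ⁻¹) ⟩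
    z ∙ a ⁻¹               ∎

-- Reduced words and centralizers of generators in a free group

module FreeGroup (X : Set) (F : Group 0ℓ 0ℓ) (ι : X → Group.Carrier F) (free : IsFreeOn X F ι) where
  open Group F hiding (refl)
  open GroupProperties F

  hom-unique : ∀ H {f g : Carrier → Group.Carrier H} → IsGroupHom F H f → IsGroupHom F H g →
    (∀ x → Group._≈_ H (f (ι x)) (g (ι x))) → ∀ a → Group._≈_ H (f a) (g a)
  hom-unique H {f} {g} f-hom g-hom eq a =
    let _ , _ , _ , unique = free H (f ∘ ι)
    in Group.trans H (Group.sym H (unique f f-hom (λ _ → Group.refl H) a))
                     (unique g g-hom (λ x → Group.sym H (eq x)) a)

  -- Conjugation by an element commuting with the generators agrees with the identity on them, hence
  -- everywhere. This is applied first to each generator, then to an arbitrary element.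
  commutingGenerators⇒abelian : (∀ x y → Commute F (ι x) (ι y)) → ∀ a b → Commute F a b
  commutingGenerators⇒abelian comm a b =
    central a (λ y → sym (central (ι y) (comm y) a)) b
    where
    central : ∀ z → (∀ y → Commute F z (ι y)) → ∀ a → Commute F z a
    central z comm-z a = conjugate⇒Commute F (hom-unique F (conjugate-hom F z)
      (groupHom F F id id (λ _ _ → Group.refl F)) (λ y → Commute⇒conjugate F (comm-z y)) a)

  module Words (em : ExcludedMiddle 0ℓ) where

    noncommutingGenerators : NonAbelian F → ∃ λ x → ∃ λ y → ¬ Commute F (ι x) (ι y)
    noncommutingGenerators (a , b , ab≉ba) with em {∃ λ x → ∃ λ y → ¬ Commute F (ι x) (ι y)}
    ... | yes p = p
    ... | no ¬p = contradiction (commutingGenerators⇒abelian comm a b) ab≉ba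
      where
      comm : ∀ x y → Commute F (ι x) (ι y)
      comm x y with em {Commute F (ι x) (ι y)}
      ... | yes c = c
      ... | no ¬c = contradiction (x , y , ¬c) ¬p

    Letter : Set
    Letter = X × Bool

    infix 8 _⁻

    _⁻ : Letter → Letter
    (x , b) ⁻ = x , not b

    ⁻-involutive : ∀ a → a ⁻ ⁻ ≡ a
    ⁻-involutive (x , true)  = refl
    ⁻-involutive (x , false) = refl

    a≢a⁻ : ∀ a → a ≢ a ⁻
    a≢a⁻ (x , true)  ()
    a≢a⁻ (x , false) ()

    letter : Letter → Carrier
    letter (x , true)  = ι x
    letter (x , false) = ι x ⁻¹

    letter-⁻ : ∀ a → letter (a ⁻) ≈ letter a ⁻¹
    letter-⁻ (x , true)  = Group.refl F
    letter-⁻ (x , false) = sym (⁻¹-involutive (ι x))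

    eval : List Letter → Carrier
    eval []      = ε
    eval (a ∷ w) = letter a ∙ eval w

    eval-++ : ∀ v w → eval (v List.++ w) ≈ eval v ∙ eval w
    eval-++ []      w = sym (identityˡ _)
    eval-++ (a ∷ v) w = trans (∙-congˡ (eval-++ v w)) (sym (assoc _ _ _))

    invert : List Letter → List Letter
    invert []      = []
    invert (a ∷ w) = invert w List.++ (a ⁻ ∷ [])

    eval-invert : ∀ w → eval (invert w) ≈ eval w ⁻¹
    eval-invert []      = sym ε⁻¹≈ε
    eval-invert (a ∷ w) = begin
      eval (invert w List.++ (a ⁻ ∷ []))  ≈⟨ eval-++ (invert w) _ ⟩
      eval (invert w) ∙ (letter (a ⁻) ∙ ε) ≈⟨ ∙-cong (eval-invert w) (trans (identityʳ _) (letter-⁻ a)) ⟩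
      eval w ⁻¹ ∙ letter a ⁻¹             ≈⟨ ⁻¹-anti-homo-∙ (letter a) (eval w) ⟨
      (letter a ∙ eval w) ⁻¹              ∎
      where open SetoidReasoning setoid

    -- Words are identified when their values in `F` agree, so the universal property supplies a
    -- spelling of every element.
    wordGroup : Group 0ℓ 0ℓ
    wordGroup = record
      { Carrier = List Letter
      ; _≈_ = λ v w → eval v ≈ eval w
      ; _∙_ = List._++_
      ; ε = []
      ; _⁻¹ = invert
      ; isGroup = record
        { isMonoid = record
          { isSemigroup = record
            { isMagma = record
              { isEquivalence = record { refl = Group.refl F ; sym = sym ; trans = trans }
              ; ∙-cong = λ {v} {v′} {w} {w′} p q →
                  trans (eval-++ v w) (trans (∙-cong p q) (sym (eval-++ v′ w′)))
              }
            ; assoc = λ u v w → reflexive (cong eval (List.++-assoc u v w))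
            }
          ; identity = (λ _ → Group.refl F) , (λ w → reflexive (cong eval (List.++-identityʳ w)))
          }
        ; inverse = (λ w → trans (eval-++ (invert w) w) (trans (∙-congʳ (eval-invert w)) (inverseˡ _)))
                  , (λ w → trans (eval-++ w (invert w)) (trans (∙-congˡ (eval-invert w)) (inverseʳ _)))
        ; ⁻¹-cong = λ {v} {w} p → trans (eval-invert v) (trans (⁻¹-cong p) (sym (eval-invert w)))
        }
      }

    spell : Carrier → List Letter
    spell = proj₁ (free wordGroup (λ x → (x , true) ∷ []))

    eval-spell : ∀ a → eval (spell a) ≈ a
    eval-spell = hom-unique F
      (groupHom F F (eval ∘ spell) ⟦⟧-cong (λ a b → trans (homo a b) (eval-++ (spell a) (spell b))))
      (groupHom F F id id (λ _ _ → Group.refl F))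
      (λ x → trans (on-generators x) (identityʳ _))
      where
      spell-hom : IsGroupHom F wordGroup spell
      spell-hom = proj₁ (proj₂ (free wordGroup (λ x → (x , true) ∷ [])))
      on-generators : ∀ x → eval (spell (ι x)) ≈ ι x ∙ ε
      on-generators = proj₁ (proj₂ (proj₂ (free wordGroup (λ x → (x , true) ∷ []))))
      open GroupMorphisms.IsGroupHomomorphism spell-hom

    Reduced : List Letter → Set
    Reduced []          = ⊤
    Reduced (a ∷ [])    = ⊤
    Reduced (a ∷ b ∷ w) = b ≢ a ⁻ × Reduced (b ∷ w)

    Reduced-tail : ∀ a w → Reduced (a ∷ w) → Reduced w
    Reduced-tail a []      _       = tt
    Reduced-tail a (b ∷ w) (_ , r) = r

    prepend : Letter → List Letter → List Letter
    prepend a []      = a ∷ []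
    prepend a (b ∷ w) with em {b ≡ a ⁻}
    ... | yes _ = w
    ... | no  _ = a ∷ b ∷ w

    prepend-Reduced : ∀ a w → Reduced w → Reduced (prepend a w)
    prepend-Reduced a []      r = tt
    prepend-Reduced a (b ∷ w) r with em {b ≡ a ⁻}
    ... | yes _   = Reduced-tail b w r
    ... | no b≢a⁻ = b≢a⁻ , r

    prepend-∷ : ∀ a w → Reduced (a ∷ w) → prepend a w ≡ a ∷ w
    prepend-∷ a []      _         = refl
    prepend-∷ a (b ∷ w) (b≢a⁻ , _) with em {b ≡ a ⁻}
    ... | yes b≡a⁻ = contradiction b≡a⁻ b≢a⁻
    ... | no _     = refl

    prepend-cancel : ∀ a w → prepend (a ⁻) (a ∷ w) ≡ w
    prepend-cancel a w with em {a ≡ a ⁻ ⁻}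
    ... | yes _  = refl
    ... | no a≢a = contradiction (≡.sym (⁻-involutive a)) a≢a

    -- If a letter was cancelled, reducedness guarantees that putting it back causes no further
    -- cancellation.
    prepend-inverse : ∀ a w → Reduced w → prepend (a ⁻) (prepend a w) ≡ w
    prepend-inverse a []      r = prepend-cancel a []
    prepend-inverse a (b ∷ w) r with em {b ≡ a ⁻}
    ... | yes refl = prepend-∷ (a ⁻) w r
    ... | no _     = prepend-cancel a (b ∷ w)

    eval-prepend : ∀ a w → eval (prepend a w) ≈ letter a ∙ eval w
    eval-prepend a []      = Group.refl F
    eval-prepend a (b ∷ w) with em {b ≡ a ⁻}
    ... | no _     = Group.refl F
    ... | yes refl = begin
      eval w                                  ≈⟨ \\-leftDividesˡ (letter a) (eval w) ⟨
      letter a ∙ (letter a ⁻¹ ∙ eval w)       ≈⟨ ∙-congˡ (∙-congʳ (letter-⁻ a)) ⟨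
      letter a ∙ (letter (a ⁻) ∙ eval w)      ∎
      where open SetoidReasoning setoid

    reducedForm : ∀ w → ∃ λ v → Reduced v × eval v ≈ eval w
    reducedForm []      = [] , tt , Group.refl F
    reducedForm (a ∷ w) =
      let v , r , eq = reducedForm w
      in prepend a v , prepend-Reduced a v r , trans (eval-prepend a v) (∙-congˡ eq)

    -- Van der Waerden's method: `F` acts on reduced words by prepending letters with cancellation,
    -- and the action recovers a reduced word from its value.
    record Permutation : Set where
      field
        fun fun⁻¹     : List Letter → List Letter
        fun-Reduced   : ∀ w → Reduced w → Reduced (fun w)
        fun⁻¹-Reduced : ∀ w → Reduced w → Reduced (fun⁻¹ w)
        inverseˡ′     : ∀ w → Reduced w → fun⁻¹ (fun w) ≡ w
        inverseʳ′     : ∀ w → Reduced w → fun (fun⁻¹ w) ≡ w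

    open Permutation

    permutationGroup : Group 0ℓ 0ℓ
    permutationGroup = record
      { Carrier = Permutation
      ; _≈_ = λ f g → ∀ w → Reduced w → fun f w ≡ fun g w
      ; _∙_ = λ f g → record
        { fun   = fun f ∘ fun g
        ; fun⁻¹ = fun⁻¹ g ∘ fun⁻¹ f
        ; fun-Reduced   = λ w r → fun-Reduced f _ (fun-Reduced g w r)
        ; fun⁻¹-Reduced = λ w r → fun⁻¹-Reduced g _ (fun⁻¹-Reduced f w r)
        ; inverseˡ′ = λ w r → ≡.trans (cong (fun⁻¹ g) (inverseˡ′ f _ (fun-Reduced g w r))) (inverseˡ′ g w r)
        ; inverseʳ′ = λ w r → ≡.trans (cong (fun f) (inverseʳ′ g _ (fun⁻¹-Reduced f w r))) (inverseʳ′ f w r)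
        }
      ; ε = record
        { fun = id ; fun⁻¹ = id ; fun-Reduced = λ _ r → r ; fun⁻¹-Reduced = λ _ r → r
        ; inverseˡ′ = λ _ _ → refl ; inverseʳ′ = λ _ _ → refl }
      ; _⁻¹ = λ f → record
        { fun = fun⁻¹ f ; fun⁻¹ = fun f
        ; fun-Reduced = fun⁻¹-Reduced f ; fun⁻¹-Reduced = fun-Reduced f
        ; inverseˡ′ = inverseʳ′ f ; inverseʳ′ = inverseˡ′ f }
      ; isGroup = record
        { isMonoid = record
          { isSemigroup = record
            { isMagma = record
              { isEquivalence = record
                { refl = λ _ _ → refl
                ; sym = λ p w r → ≡.sym (p w r)
                ; trans = λ p q w r → ≡.trans (p w r) (q w r)
                }
              ; ∙-cong = λ {f} {f′} {g} {g′} p q w r →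
                  ≡.trans (cong (fun f) (q w r)) (p _ (fun-Reduced g′ w r))
              }
            ; assoc = λ _ _ _ _ _ → refl
            }
          ; identity = (λ _ _ _ → refl) , (λ _ _ _ → refl)
          }
        ; inverse = inverseˡ′ , inverseʳ′
        ; ⁻¹-cong = λ {f} {g} p w r →
            ≡.trans (cong (fun⁻¹ f) (≡.sym (≡.trans (p _ (fun⁻¹-Reduced g w r)) (inverseʳ′ g w r))))
                    (inverseˡ′ f _ (fun⁻¹-Reduced g w r))
        }
      }

    prependPermutation : Letter → Permutation
    prependPermutation a = record
      { fun = prepend a
      ; fun⁻¹ = prepend (a ⁻)
      ; fun-Reduced = prepend-Reduced a
      ; fun⁻¹-Reduced = prepend-Reduced (a ⁻)
      ; inverseˡ′ = prepend-inverse a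
      ; inverseʳ′ = λ w r → ≡.subst (λ b → prepend b (prepend (a ⁻) w) ≡ w) (⁻-involutive a)
          (prepend-inverse (a ⁻) w r)
      }

    private
      action = free permutationGroup (λ x → prependPermutation (x , true))

    act : Carrier → Permutation
    act = proj₁ action

    open GroupMorphisms.IsGroupHomomorphism (proj₁ (proj₂ action))
      renaming (⟦⟧-cong to act-cong; homo to act-∙; ε-homo to act-ε; ⁻¹-homo to act-⁻¹)

    act-letter : ∀ a w → Reduced w → fun (act (letter a)) w ≡ prepend a w
    act-letter (x , true)  w r = proj₁ (proj₂ (proj₂ action)) x w r
    act-letter (x , false) w r = ≡.trans (act-⁻¹ (ι x) w r)
      (Group.⁻¹-cong permutationGroup {act (ι x)} {prependPermutation (x , true)}
        (proj₁ (proj₂ (proj₂ action)) x) w r)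

    Reduced-++ʳ : ∀ v w → Reduced (v List.++ w) → Reduced w
    Reduced-++ʳ []      w r = r
    Reduced-++ʳ (a ∷ v) w r = Reduced-++ʳ v w (Reduced-tail a (v List.++ w) r)

    -- No letter of `v` cancels when prepended, as the whole word is reduced. Applied to the empty
    -- word, the action returns the reduced word itself.
    act-eval : ∀ v w → Reduced (v List.++ w) → fun (act (eval v)) w ≡ v List.++ w
    act-eval []      w r = act-ε w r
    act-eval (a ∷ v) w r = begin
      fun (act (letter a ∙ eval v)) w              ≡⟨ act-∙ (letter a) (eval v) w w-Reduced ⟩
      fun (act (letter a)) (fun (act (eval v)) w)  ≡⟨ cong (fun (act (letter a))) (act-eval v w vw-Reduced) ⟩
      fun (act (letter a)) (v List.++ w)           ≡⟨ act-letter a _ vw-Reduced ⟩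
      prepend a (v List.++ w)                      ≡⟨ prepend-∷ a _ r ⟩
      a ∷ v List.++ w                              ∎
      where
      open ≡.≡-Reasoning
      vw-Reduced : Reduced (v List.++ w)
      vw-Reduced = Reduced-tail a (v List.++ w) r
      w-Reduced : Reduced w
      w-Reduced = Reduced-++ʳ v w vw-Reduced

    -- The last letter of `w` can cancel only one of the two. Commuting with `a` and with its
    -- inverse being equivalent, the side without cancellation may be chosen.
    Reduced-∷ʳ : ∀ a w → Reduced w → Reduced (w ∷ʳ a) ⊎ Reduced (w ∷ʳ a ⁻)
    Reduced-∷ʳ a []          r = inj₁ tt
    Reduced-∷ʳ a (b ∷ [])    r with em {a ≡ b ⁻}
    ... | no a≢b⁻  = inj₁ (a≢b⁻ , tt)
    ... | yes refl = inj₂ ((λ eq → a≢a⁻ b (≡.trans (≡.sym (⁻-involutive b)) eq)) , tt)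
    Reduced-∷ʳ a (b ∷ c ∷ w) (c≢b⁻ , r) = Sum.map (c≢b⁻ ,_) (c≢b⁻ ,_) (Reduced-∷ʳ a (c ∷ w) r)

    -- Both products act on the empty word with the same result. One order gives a word beginning
    -- with `b`; the other begins with `a` unless `a` cancels `b`.
    commuting⇒head : ∀ a b w → Reduced (b ∷ w) → Reduced ((b ∷ w) ∷ʳ a) →
      Commute F (eval (b ∷ w)) (letter a) → b ≡ a ⊎ b ≡ a ⁻
    commuting⇒head a b w r r′ comm with em {b ≡ a ⁻} | ≡.trans (≡.sym eq₁) eq₂
      where
      eq₁ : fun (act (letter a ∙ eval (b ∷ w))) [] ≡ prepend a (b ∷ w)
      eq₁ = ≡.trans (act-∙ (letter a) (eval (b ∷ w)) [] tt) (≡.trans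
        (cong (fun (act (letter a))) (≡.trans (act-eval (b ∷ w) [] (≡.subst Reduced (≡.sym (List.++-identityʳ (b ∷ w))) r))
          (List.++-identityʳ (b ∷ w)))) (act-letter a (b ∷ w) r))
      eq₂ : fun (act (letter a ∙ eval (b ∷ w))) [] ≡ (b ∷ w) ∷ʳ a
      eq₂ = ≡.trans (act-cong (sym comm) [] tt) (≡.trans (act-∙ (eval (b ∷ w)) (letter a) [] tt)
        (≡.trans (cong (fun (act (eval (b ∷ w)))) (act-letter a [] tt)) (act-eval (b ∷ w) (a ∷ []) r′)))
    ... | yes b≡a⁻ | _  = inj₂ b≡a⁻
    ... | no b≢a⁻  | eq = inj₁ (≡.sym (List.∷-injectiveˡ eq))

    data PowerOf (a : Letter) : List Letter → Set where
      one  : PowerOf a (a ∷ [])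
      more : ∀ {w} → PowerOf a w → PowerOf a (a ∷ w)

    -- The first letter is `a` or its inverse; stripping it leaves a shorter word that still
    -- commutes with `a`. Reducedness prevents the two signs from mixing.
    centralizer-of-letter : ∀ a w → Reduced w → Commute F (eval w) (letter a) →
      w ≡ [] ⊎ PowerOf a w ⊎ PowerOf (a ⁻) w
    centralizer-of-letter a [] r comm = inj₁ refl
    centralizer-of-letter a (b ∷ w) r comm = inj₂ (extend-by head (centralizer-of-letter a w r-w comm-w))
      where
      r-w : Reduced w
      r-w = Reduced-tail b w r
      comm⁻ : ∀ {z} → Commute F z (letter a) → Commute F z (letter (a ⁻))
      comm⁻ c = trans (∙-congˡ (letter-⁻ a)) (trans (sym (Commute-⁻¹ F (sym c))) (∙-congʳ (sym (letter-⁻ a))))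
      head : b ≡ a ⊎ b ≡ a ⁻
      head with Reduced-∷ʳ a (b ∷ w) r
      ... | inj₁ r′ = commuting⇒head a b w r r′ comm
      ... | inj₂ r′ with commuting⇒head (a ⁻) b w r r′ (comm⁻ comm)
      ...   | inj₁ eq = inj₂ eq
      ...   | inj₂ eq = inj₁ (≡.trans eq (⁻-involutive a))
      comm-b : b ≡ a ⊎ b ≡ a ⁻ → Commute F (letter b) (letter a)
      comm-b (inj₁ refl) = Group.refl F
      comm-b (inj₂ refl) = sym (comm⁻ {letter a} (Group.refl F))
      comm-w : Commute F (eval w) (letter a)
      comm-w = trans (∙-congʳ cancel) (trans (Commute-∙ F (Commute-⁻¹ F (comm-b head)) comm) (∙-congˡ (sym cancel)))
        where
        cancel : eval w ≈ letter b ⁻¹ ∙ eval (b ∷ w)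
        cancel = sym (\\-leftDividesʳ (letter b) (eval w))
      not-cancelling : ∀ {c} → PowerOf (c ⁻) w → b ≢ c
      not-cancelling {c} one      refl = proj₁ r refl
      not-cancelling {c} (more _) refl = proj₁ r refl
      extend-by : b ≡ a ⊎ b ≡ a ⁻ → w ≡ [] ⊎ PowerOf a w ⊎ PowerOf (a ⁻) w →
        PowerOf a (b ∷ w) ⊎ PowerOf (a ⁻) (b ∷ w)
      extend-by (inj₁ refl) (inj₁ refl)     = inj₁ one
      extend-by (inj₁ refl) (inj₂ (inj₁ p)) = inj₁ (more p)
      extend-by (inj₁ refl) (inj₂ (inj₂ p)) = contradiction refl (not-cancelling p)
      extend-by (inj₂ refl) (inj₁ refl)     = inj₂ one
      extend-by (inj₂ refl) (inj₂ (inj₂ p)) = inj₂ (more p)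
      extend-by (inj₂ refl) (inj₂ (inj₁ p)) =
        contradiction refl (not-cancelling (≡.subst (λ c → PowerOf c w) (≡.sym (⁻-involutive a)) p))

-- Naturality of the twist, and conjugations as automorphisms

module _ (G : Group 0ℓ 0ℓ) where
  open Group G
  open Twist G

  u-cong : ∀ {e e′ g g′} → e ≈ e′ → g ≈ g′ → u e g ≈ u e′ g′
  u-cong p q = ∙-cong v-cong v-cong
    where v-cong = ∙-cong (⁻¹-cong q) (∙-cong p (∙-cong q (⁻¹-cong p)))

  twist-cong : ∀ {e e′ g g′ s s′} → e ≈ e′ → g ≈ g′ → s ≈ s′ → twist e g s ≈ twist e′ g′ s′
  twist-cong p q r = ∙-cong q (∙-cong (u-cong p q) (∙-cong r (⁻¹-cong (u-cong p q))))

module _ (G H : Group 0ℓ 0ℓ) {f : Group.Carrier G → Group.Carrier H} (f-hom : IsGroupHom G H f) where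
  open Group H
  open GroupMorphisms.IsGroupHomomorphism f-hom

  hom-conjugate : ∀ z a → f (conjugate G z a) ≈ conjugate H (f z) (f a)
  hom-conjugate z a = trans (homo _ _) (∙-congˡ (trans (homo _ _) (∙-congˡ (⁻¹-homo z))))

  hom-u : ∀ e g → f (Twist.u G e g) ≈ Twist.u H (f e) (f g)
  hom-u e g = trans (homo _ _) (∙-cong hom-v hom-v)
    where hom-v = trans (homo _ _) (∙-cong (⁻¹-homo g) (trans (homo _ _)
                    (∙-congˡ (trans (homo _ _) (∙-congˡ (⁻¹-homo e))))))

  hom-twist : ∀ e g s → f (Twist.twist G e g s) ≈ Twist.twist H (f e) (f g) (f s)
  hom-twist e g s = trans (homo _ _) (∙-congˡ (trans (homo _ _)
    (∙-cong (hom-u e g) (trans (homo _ _) (∙-congˡ (trans (⁻¹-homo _) (⁻¹-cong (hom-u e g))))))))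

module _ (G : Group 0ℓ 0ℓ) where
  open Group G
  open GroupProperties G
  open SetoidReasoning setoid

  power : Carrier → ℕ → Carrier
  power a zero    = ε
  power a (suc n) = a ∙ power a n

  Commute-power : ∀ a n → Commute G (power a n) a
  Commute-power a zero    = trans (identityˡ a) (sym (identityʳ a))
  Commute-power a (suc n) = Commute-∙ G (Group.refl G) (Commute-power a n)

  conjugate-ε : ∀ a → conjugate G ε a ≈ a
  conjugate-ε a = Commute⇒conjugate G (trans (identityˡ a) (sym (identityʳ a)))

  intertwines⇒Commute : ∀ {h g a} → h ∙ a ≈ conjugate G g a ∙ h → Commute G (g ⁻¹ ∙ h) a
  intertwines⇒Commute {h} {g} {a} ha≈ah = begin
    g ⁻¹ ∙ h ∙ a                        ≈⟨ assoc (g ⁻¹) h a ⟩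
    g ⁻¹ ∙ (h ∙ a)                      ≈⟨ ∙-congˡ ha≈ah ⟩
    g ⁻¹ ∙ (g ∙ (a ∙ g ⁻¹) ∙ h)         ≈⟨ ∙-congˡ (assoc g _ h) ⟩
    g ⁻¹ ∙ (g ∙ (a ∙ g ⁻¹ ∙ h))         ≈⟨ \\-leftDividesʳ g _ ⟩
    a ∙ g ⁻¹ ∙ h                        ≈⟨ assoc a (g ⁻¹) h ⟩
    a ∙ (g ⁻¹ ∙ h)                      ∎

  conjugate-intertwines : ∀ g a → g ∙ a ≈ conjugate G g a ∙ g
  conjugate-intertwines g a = begin
    g ∙ a                 ≈⟨ ∙-congˡ (//-rightDividesˡ g a) ⟨
    g ∙ (a ∙ g ⁻¹ ∙ g)    ≈⟨ assoc g _ g ⟨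
    g ∙ (a ∙ g ⁻¹) ∙ g    ∎

  conjugate-translate : ∀ {z x x′} → z ∙ x ≈ x′ → ∀ a → z ∙ conjugate G x a ≈ conjugate G x′ a ∙ z
  conjugate-translate {z} {x} {x′} zx≈x′ a = begin
    z ∙ (x ∙ (a ∙ x ⁻¹))              ≈⟨ assoc z x _ ⟨
    z ∙ x ∙ (a ∙ x ⁻¹)                ≈⟨ ∙-congʳ zx≈x′ ⟩
    x′ ∙ (a ∙ x ⁻¹)                   ≈⟨ ∙-congˡ (∙-congˡ x⁻¹≈x′⁻¹z) ⟩
    x′ ∙ (a ∙ (x′ ⁻¹ ∙ z))            ≈⟨ ∙-congˡ (assoc a _ z) ⟨
    x′ ∙ (a ∙ x′ ⁻¹ ∙ z)              ≈⟨ assoc x′ _ z ⟨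
    x′ ∙ (a ∙ x′ ⁻¹) ∙ z              ∎
    where
    x⁻¹≈x′⁻¹z : x ⁻¹ ≈ x′ ⁻¹ ∙ z
    x⁻¹≈x′⁻¹z = begin
      x ⁻¹                ≈⟨ //-rightDividesˡ z (x ⁻¹) ⟨
      x ⁻¹ ∙ z ⁻¹ ∙ z     ≈⟨ ∙-congʳ (⁻¹-anti-homo-∙ z x) ⟨
      (z ∙ x) ⁻¹ ∙ z      ≈⟨ ∙-congʳ (⁻¹-cong zx≈x′) ⟩
      x′ ⁻¹ ∙ z           ∎

  conjugation : Carrier → Automorphism (groupStructure G)
  conjugation z = record
    { _~_    = λ a a′ → z ∙ a ≈ a′ ∙ z
    ; ~-op   = λ {a} {a′} {b} {b′} p q → begin
        z ∙ (a ∙ b)   ≈⟨ assoc z a b ⟨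
        z ∙ a ∙ b     ≈⟨ ∙-congʳ p ⟩
        a′ ∙ z ∙ b    ≈⟨ assoc a′ z b ⟩
        a′ ∙ (z ∙ b)  ≈⟨ ∙-congˡ q ⟩
        a′ ∙ (b′ ∙ z) ≈⟨ assoc a′ b′ z ⟨
        a′ ∙ b′ ∙ z   ∎
    ; ~-inv  = λ {a} {a′} p → begin
        z ∙ a ⁻¹                      ≈⟨ \\-leftDividesʳ a′ _ ⟨
        a′ ⁻¹ ∙ (a′ ∙ (z ∙ a ⁻¹))     ≈⟨ ∙-congˡ (assoc a′ z _) ⟨
        a′ ⁻¹ ∙ (a′ ∙ z ∙ a ⁻¹)       ≈⟨ ∙-congˡ (∙-congʳ p) ⟨
        a′ ⁻¹ ∙ (z ∙ a ∙ a ⁻¹)        ≈⟨ ∙-congˡ (//-rightDividesʳ a z) ⟩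
        a′ ⁻¹ ∙ z                     ∎
    ; ~-unit = trans (identityʳ z) (sym (identityˡ z))
    ; ~-≈    = λ {a} {a′} {b} {b′} p q →
        (λ a≈b → ∙-cancelʳ z a′ b′ (trans (sym p) (trans (∙-congˡ a≈b) q)))
      , (λ a′≈b′ → ∙-cancelˡ z a b (trans p (trans (∙-congʳ a′≈b′) (sym q))))
    ; to     = λ a → conjugate G z a , conjugate-intertwines z a
    ; from   = λ a′ → z ⁻¹ ∙ (a′ ∙ z) , \\-leftDividesˡ z (a′ ∙ z)
    }

-- The formula for the twisted set, and closedness of equations

bounded : (J : List ℕ) → ∃ λ k → All (_< k) J
bounded []      = 0 , []
bounded (j ∷ J) = let k , J<k = bounded J in
  suc j ⊔ k , ℕ.m≤m⊔n (suc j) k ∷ All.map (λ i<k → ℕ.<-≤-trans i<k (ℕ.m≤n⊔m (suc j) k)) J<k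

-- At the conjugates of (e₁,e₂) by x and by y, the conjugator h is yx⁻¹ up to the
-- centralizer of the frame, that is x⁻¹y after conjugation by x⁻¹.
twistFormula : Formula (2 ℕ.+ 2)
twistFormula = ∃' (∃' (∃' (
  ((h ·' α₁) ≐ (β₁ ·' h)) ∧' (((h ·' α₂) ≐ (β₂ ·' h)) ∧' (
  ((s ·' α₁) ≐ (α₁ ·' s)) ∧' ((¬' (s ≐ e')) ∧' (
  h ≐ (g ·' (u ·' (s ·' inv' u))))))))))
  where
  s g h α₁ α₂ β₁ β₂ v u : Term 7
  s  = var zero
  g  = var (suc zero)
  h  = var (suc (suc zero))
  α₁ = var (suc (suc (suc zero)))
  α₂ = var (suc (suc (suc (suc zero))))
  β₁ = var (suc (suc (suc (suc (suc zero)))))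
  β₂ = var (suc (suc (suc (suc (suc (suc zero))))))
  v  = inv' g ·' (α₁ ·' (g ·' inv' α₁))
  u  = v ·' v

module Orbits (G : Group 0ℓ 0ℓ) (e₁ e₂ : Group.Carrier G) where
  open Group G
  open GroupProperties G

  frame : Carrier → Vector Carrier 2
  frame x zero    = conjugate G x e₁
  frame x (suc _) = conjugate G x e₂

  -- Conjugation by `z` is an automorphism that carries the frame at x to the frame at zx. Taking z
  -- = x⁻¹ moves the first frame to the identity.
  Sat-translate : ∀ (φ : Formula (2 ℕ.+ 2)) {z x x′ y y′} → z ∙ x ≈ x′ → z ∙ y ≈ y′ →
    Sat (groupStructure G) φ (frame x ++ frame y) ⟺ Sat (groupStructure G) φ (frame x′ ++ frame y′)
  Sat-translate φ {z} p q = Sat-invariant (conjugation G z) φ λ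
    { zero                   → conjugate-translate G p e₁
    ; (suc zero)             → conjugate-translate G p e₂
    ; (suc (suc zero))       → conjugate-translate G q e₁
    ; (suc (suc (suc zero))) → conjugate-translate G q e₂
    }

  Holds : Formula (2 ℕ.+ 2) → Carrier → Set
  Holds φ g = Sat (groupStructure G) φ (frame ε ++ frame g)

  -- The instances at the frames of all y are equivalent to those with index in a finite `J`. For
  -- `k` beyond `J` the off-diagonal hypotheses give these at the frame of `x k`, hence also the
  -- instance with index `k`, which is the diagonal one.
  equation⇒Closed : (em : ExcludedMiddle 0ℓ) → ∀ φ →
    IsEquation (Th (groupStructure G)) 2 2 φ → Descent.Closed em G (Holds φ)
  equation⇒Closed em φ eqn x y g diag off =
    let J , finite = eqn (groupStructure G) (λ _ p → p) ℕ (frame ∘ y)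
        k , J<k    = bounded J
        all-J      = All.map (λ j<k → proj₂ (Sat-translate φ (inverseˡ (x k)) (Group.refl G)) (off j<k)) J<k
    in proj₁ (Sat-translate φ (inverseˡ (x k)) (diag k)) (finite (frame (x k)) all-J k)

  notAlternating : (em : ExcludedMiddle 0ℓ) → Equational (Th (groupStructure G)) →
    ∀ φ → ¬ Descent.Alternating em G (Holds φ)
  notAlternating em equational φ =
    let ψ , c , equiv = equational 2 2 φ
        M             = groupStructure G
        S             = λ (θ , _) → Holds θ
        closed        = All.map⁺ {f = S} (All.universal (λ (θ , eqn) → equation⇒Closed em θ eqn) (atoms c))
    in Descent.alternating-¬boolComb em G closed λ g h agree →
      let to , from   = boolComb-determined M c (All.map⁻ {f = S} agree)
          φ⇒ψ , ψ⇒φ   = equiv M (λ _ p → p) (frame ε ++ frame h)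
          φ⇒ψ′ , ψ⇒φ′ = equiv M (λ _ p → p) (frame ε ++ frame g)
      in (ψ⇒φ′ ∘ to ∘ φ⇒ψ) , (ψ⇒φ ∘ from ∘ φ⇒ψ′)

-- The twisted set of a nonabelian free group alternates

δ-dark : ∀ {l m} → l ℤ.< m → δ (m ℤ.- l) ≡ 0ℤ
δ-dark {l} {m} l<m with m ℤ.- l | ≡.subst (ℤ._< m ℤ.- l) (ℤ.+-inverseʳ l) (ℤ.+-monoˡ-< (ℤ.- l) l<m)
... | + suc _ | _       = refl
... | + zero  | +<+ ()

module NonabelianFree (X : Set) (F : Group 0ℓ 0ℓ) (ι : X → Group.Carrier F) (free : IsFreeOn X F ι)
  (em : ExcludedMiddle 0ℓ) (x₁ x₂ : X) (x₁x₂≉x₂x₁ : ¬ Commute F (ι x₁) (ι x₂)) where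

  open Group F hiding (refl)
  open GroupProperties F
  open FreeGroup X F ι free
  open Words em
  open Wreath
  open Twist F
  open Twist wreathGroup using () renaming (twist to twistʷ)
  private
    module W = Group wreathGroup
    e₁ e₂ : Carrier
    e₁ = ι x₁
    e₂ = ι x₂
  open Orbits F e₁ e₂

  generatorImage : X → Wreath
  generatorImage x with em {x ≡ x₁} | em {x ≡ x₂}
  ... | yes _ | _     = step
  ... | no  _ | yes _ = lit
  ... | no  _ | no  _ = εʷ

  private
    representation = free wreathGroup generatorImage

  η : Carrier → Wreath
  η = proj₁ representation

  η-hom : IsGroupHom F wreathGroup η
  η-hom = proj₁ (proj₂ representation)

  open GroupMorphisms.IsGroupHomomorphism η-hom
    renaming (⟦⟧-cong to η-cong; homo to η-∙; ε-homo to η-ε; ⁻¹-homo to η-⁻¹)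

  η-e₁ : η e₁ ≈ʷ step
  η-e₁ = W.trans {η e₁} {generatorImage x₁} {step} (proj₁ (proj₂ (proj₂ representation)) x₁) image
    where
    image : generatorImage x₁ ≈ʷ step
    image with em {x₁ ≡ x₁} | em {x₁ ≡ x₂}
    ... | yes _   | _ = W.refl {step}
    ... | no x₁≢x₁ | _ = contradiction refl x₁≢x₁

  η-e₂ : η e₂ ≈ʷ lit
  η-e₂ = W.trans {η e₂} {generatorImage x₂} {lit} (proj₁ (proj₂ (proj₂ representation)) x₂) image
    where
    image : generatorImage x₂ ≈ʷ lit
    image with em {x₂ ≡ x₁} | em {x₂ ≡ x₂}
    -- The two indices differ because a generator commutes with itself.
    ... | yes refl | _        = contradiction (Group.refl F) x₁x₂≉x₂x₁
    ... | no _     | yes _    = W.refl {lit}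
    ... | no _     | no x₂≢x₂ = contradiction refl x₂≢x₂

  pos-power⁺ : ∀ {w} → PowerOf (x₁ , true) w → ∃ λ n → pos (η (eval w)) ≡ + suc n
  pos-power⁺ one = 0 , ≡.trans (proj₂ (η-∙ e₁ ε)) (cong₂ ℤ._+_ (proj₂ η-e₁) (proj₂ η-ε))
  pos-power⁺ (more {w} p) = let n , eq = pos-power⁺ p in
    suc n , ≡.trans (proj₂ (η-∙ e₁ (eval w))) (cong₂ ℤ._+_ (proj₂ η-e₁) eq)

  pos-power⁻ : ∀ {w} → PowerOf (x₁ , false) w → ∃ λ n → pos (η (eval w)) ≡ -[1+ n ]
  pos-power⁻ one = 0 , ≡.trans (proj₂ (η-∙ (e₁ ⁻¹) ε))
    (cong₂ ℤ._+_ (≡.trans (proj₂ (η-⁻¹ e₁)) (cong ℤ.-_ (proj₂ η-e₁))) (proj₂ η-ε))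
  pos-power⁻ (more {w} p) = let n , eq = pos-power⁻ p in
    suc n , ≡.trans (proj₂ (η-∙ (e₁ ⁻¹) (eval w)))
      (cong₂ ℤ._+_ (≡.trans (proj₂ (η-⁻¹ e₁)) (cong ℤ.-_ (proj₂ η-e₁))) eq)

  -- The centralizer of a generator consists of its powers, and `η` turns the exponent into the
  -- position. This gives the nonzero n of the parity argument.
  centralizer-pos : ∀ s → Commute F s e₁ → ¬ s ≈ ε → pos (η s) ≢ 0ℤ
  centralizer-pos s comm s≉ε pos≡0 with reducedForm (spell s)
  ... | w , r , eq with trans eq (eval-spell s)
  ...   | w≈s with centralizer-of-letter (x₁ , true) w r (trans (∙-congʳ w≈s) (trans comm (∙-congˡ (sym w≈s))))
  ...     | inj₁ refl     = s≉ε (sym w≈s)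
  ...     | inj₂ (inj₁ p) = let _ , q = pos-power⁺ p in
            contradiction (≡.trans (≡.sym q) (≡.trans (proj₂ (η-cong w≈s)) pos≡0)) λ ()
  ...     | inj₂ (inj₂ p) = let _ , q = pos-power⁻ p in
            contradiction (≡.trans (≡.sym q) (≡.trans (proj₂ (η-cong w≈s)) pos≡0)) λ ()

  D : Carrier → Set
  D = Holds twistFormula

  D-intro : ∀ g s {g′} → Commute F s e₁ → ¬ s ≈ ε → g′ ≈ twist e₁ g s → D g′
  -- The conjugator h is `g′` itself, which carries the frame at the identity to the frame at `g′`.
  D-intro g s {g′} comm s≉ε g′≈ = g′ , g , s ,
      trans (∙-congˡ (conjugate-ε F e₁)) (conjugate-intertwines F g′ e₁)
    , trans (∙-congˡ (conjugate-ε F e₂)) (conjugate-intertwines F g′ e₂)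
    , trans (∙-congˡ (conjugate-ε F e₁)) (trans comm (∙-congʳ (sym (conjugate-ε F e₁))))
    , s≉ε
    , trans g′≈ (twist-cong F (sym (conjugate-ε F e₁)) (Group.refl F) (Group.refl F))

  -- The conjugator h in the formula differs from `g′` by an element commuting with both generators.
  -- Its image in ℤ ≀ ℤ is trivial, so `g′` has the same image as a genuine twist.
  D-elim : ∀ {g′} → D g′ → ∃ λ (p : ℤ → ℤ) → ∃ λ b → ∃ λ n → DarkAbove b p × n ≢ 0ℤ ×
    (∀ i → lamp (η g′) i ≡ twisted p n i)
  D-elim {g′} (h , g , s , hα₁ , hα₂ , comm , s≉ε , h≈) =
    lamp (η g) , bound (η g) , pos (η s) , dark (η g) , centralizer-pos s comm-s s≉ε ,
    λ i → ≡.trans (proj₁ ηg′≈ i) (twistʷ-lamp (η g) (η s) unlit-s i)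
    where
    comm-s : Commute F s e₁
    comm-s = trans (∙-congˡ (sym (conjugate-ε F e₁))) (trans comm (∙-congʳ (conjugate-ε F e₁)))
    η-Commute : ∀ {z a c} → η a ≈ʷ c → Commute F z a → Commute wreathGroup (η z) c
    η-Commute {z} {a} {c} ηa≈c za≈az =
      W.trans {η z ∙ʷ c} {η z ∙ʷ η a} {c ∙ʷ η z} (W.∙-congˡ {η z} {c} {η a} (W.sym {η a} {c} ηa≈c))
        (W.trans {η z ∙ʷ η a} {η a ∙ʷ η z} {c ∙ʷ η z} (hom-Commute F wreathGroup η-hom za≈az)
          (W.∙-congʳ {η z} {η a} {c} ηa≈c))
    unlit-s : ∀ i → lamp (η s) i ≡ 0ℤ
    unlit-s = step-commuting⇒unlit (η s) (η-Commute {s} {e₁} {step} η-e₁ comm-s)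
    k : Carrier
    k = g′ ⁻¹ ∙ h
    k-comm : ∀ {a} → h ∙ conjugate F ε a ≈ conjugate F g′ a ∙ h → Commute F k a
    k-comm {a} eq = intertwines⇒Commute F (trans (∙-congˡ (sym (conjugate-ε F a))) eq)
    ηk≈ε : η k ≈ʷ εʷ
    ηk≈ε = centralizer-trivial (η k) (η-Commute {k} {e₁} {step} η-e₁ (k-comm hα₁))
      (η-Commute {k} {e₂} {lit} η-e₂ (k-comm hα₂))
    ηh≈ηg′ : η h ≈ʷ η g′
    ηh≈ηg′ = begin
      η h              ≈⟨ η-cong (\\-leftDividesˡ g′ h) ⟨
      η (g′ ∙ k)       ≈⟨ η-∙ g′ k ⟩
      η g′ ∙ʷ η k      ≈⟨ W.∙-congˡ {η g′} {η k} {εʷ} ηk≈ε ⟩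
      η g′ ∙ʷ εʷ       ≈⟨ W.identityʳ (η g′) ⟩
      η g′             ∎
      where open SetoidReasoning W.setoid
    ηg′≈ : η g′ ≈ʷ twistʷ step (η g) (η s)
    ηg′≈ = begin
      η g′                           ≈⟨ ηh≈ηg′ ⟨
      η h                            ≈⟨ η-cong (trans h≈ (twist-cong F (conjugate-ε F e₁) (Group.refl F) (Group.refl F))) ⟩
      η (twist e₁ g s)               ≈⟨ hom-twist F wreathGroup η-hom e₁ g s ⟩
      twistʷ (η e₁) (η g) (η s)      ≈⟨ twist-cong wreathGroup {η e₁} {step} {η g} {η g} {η s} {η s} η-e₁ (W.refl {η g}) (W.refl {η s}) ⟩
      twistʷ step (η g) (η s)        ∎
      where open SetoidReasoning W.setoid

  η-power : ∀ n → (∀ i → lamp (η (power F e₁ n)) i ≡ 0ℤ) × pos (η (power F e₁ n)) ≡ + n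
  η-power zero    = η-ε
  η-power (suc n) = let unlit , pos≡n = η-power n in
      (λ i → ≡.trans (proj₁ (η-∙ e₁ (power F e₁ n)) i) (cong₂ ℤ._+_ (proj₁ η-e₁ i) (unlit _)))
    , ≡.trans (proj₂ (η-∙ e₁ (power F e₁ n))) (cong₂ ℤ._+_ (proj₂ η-e₁) pos≡n)

  -- An element of `F` whose image under `η` is a single lamp at `l`.
  beacon : ℕ → Carrier
  beacon l = conjugate F (power F e₁ l) e₂

  beaconʷ : ℕ → Wreath
  beaconʷ l = record
    { lamp = λ i → δ (i ℤ.- + l) ; pos = 0ℤ ; bound = + l ; dark = λ i → δ-dark {+ l} {i} }

  η-beacon : ∀ l → η (beacon l) ≈ʷ beaconʷ l
  η-beacon l = W.trans {η (beacon l)} {conjugate wreathGroup a lit} {beaconʷ l}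
    (W.trans {η (beacon l)} {conjugate wreathGroup a (η e₂)} {conjugate wreathGroup a lit}
      (hom-conjugate F wreathGroup η-hom (power F e₁ l) e₂)
      (W.∙-congˡ {a} {η e₂ ∙ʷ (a ⁻¹ʷ)} {lit ∙ʷ (a ⁻¹ʷ)} (W.∙-congʳ {a ⁻¹ʷ} {η e₂} {lit} η-e₂)))
    (lamp-beacon , pos-beacon)
    where
    a : Wreath
    a = η (power F e₁ l)
    lamp-beacon : ∀ i → lamp (conjugate wreathGroup a lit) i ≡ δ (i ℤ.- + l)
    lamp-beacon i = ≡.trans (cong₂ ℤ._+_ (proj₁ (η-power l) i)
        (cong₂ ℤ._+_ (cong (λ k → δ (i ℤ.- k)) (proj₂ (η-power l))) (cong ℤ.-_ (proj₁ (η-power l) _))))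
      (≡.trans (ℤ.+-identityˡ _) (ℤ.+-identityʳ _))
    pos-beacon : pos (conjugate wreathGroup a lit) ≡ 0ℤ
    pos-beacon = ≡.trans (cong (λ k → pos a ℤ.+ k) (ℤ.+-identityˡ _)) (ℤ.+-inverseʳ (pos a))

  -- The lamp at `l` lies beyond the lamp at `m` and all lamps of `g`, so the product has top
  -- coefficient 1, which `twisted-noOddTop` excludes.
  beacon-¬D : ∀ g l m → bound (η g) ℤ.< + l → m < l → ¬ D ((beacon l ⁻¹) ⁻¹ ∙ (beacon m ⁻¹ ∙ g))
  beacon-¬D g l m b<l m<l d =
    let p , b , n , dark-p , n≢0 , twisted≡ = D-elim d
    in twisted-noOddTop p b n (+ l) dark-p n≢0
         (≡.trans (≡.sym (twisted≡ (+ l))) (≡.trans (lamp≡ (+ l)) top))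
         (λ i l<i → ≡.trans (≡.sym (twisted≡ i)) (≡.trans (lamp≡ i) (above i l<i)))
    where
    total : Wreath
    total = beaconʷ l ∙ʷ ((beaconʷ m ⁻¹ʷ) ∙ʷ η g)
    η≈ : η ((beacon l ⁻¹) ⁻¹ ∙ (beacon m ⁻¹ ∙ g)) ≈ʷ total
    η≈ = begin
      η ((beacon l ⁻¹) ⁻¹ ∙ (beacon m ⁻¹ ∙ g))      ≈⟨ η-cong (∙-congʳ (⁻¹-involutive (beacon l))) ⟩
      η (beacon l ∙ (beacon m ⁻¹ ∙ g))              ≈⟨ η-∙ (beacon l) _ ⟩
      η (beacon l) ∙ʷ η (beacon m ⁻¹ ∙ g)           ≈⟨ W.∙-cong {η (beacon l)} {beaconʷ l} {η (beacon m ⁻¹ ∙ g)} {(beaconʷ m ⁻¹ʷ) ∙ʷ η g} (η-beacon l) right ⟩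
      total                                         ∎
      where
      open SetoidReasoning W.setoid
      right : η (beacon m ⁻¹ ∙ g) ≈ʷ ((beaconʷ m ⁻¹ʷ) ∙ʷ η g)
      right = begin
        η (beacon m ⁻¹ ∙ g)              ≈⟨ η-∙ (beacon m ⁻¹) g ⟩
        η (beacon m ⁻¹) ∙ʷ η g           ≈⟨ W.∙-congʳ {η g} {η (beacon m ⁻¹)} {η (beacon m) ⁻¹ʷ} (η-⁻¹ (beacon m)) ⟩
        (η (beacon m) ⁻¹ʷ) ∙ʷ η g        ≈⟨ W.∙-congʳ {η g} {η (beacon m) ⁻¹ʷ} {beaconʷ m ⁻¹ʷ} (W.⁻¹-cong {η (beacon m)} {beaconʷ m} (η-beacon m)) ⟩
        (beaconʷ m ⁻¹ʷ) ∙ʷ η g           ∎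
    lamp≡ : ∀ i → lamp (η ((beacon l ⁻¹) ⁻¹ ∙ (beacon m ⁻¹ ∙ g))) i ≡
      δ (i ℤ.- + l) ℤ.+ (ℤ.- δ (i ℤ.- + m) ℤ.+ lamp (η g) i)
    lamp≡ i = ≡.trans (proj₁ η≈ i) (cong₂ (λ j j′ → δ (i ℤ.- + l) ℤ.+ (ℤ.- δ (j ℤ.- + m) ℤ.+ lamp (η g) j′))
      (≡.trans (ℤ.+-identityʳ _) (ℤ.+-identityʳ i)) (≡.trans (ℤ.+-identityʳ _) (ℤ.+-identityʳ i)))
    rest : ∀ i → + l ℤ.≤ i → ℤ.- δ (i ℤ.- + m) ℤ.+ lamp (η g) i ≡ 0ℤ
    rest i l≤i = cong₂ (λ a b → ℤ.- a ℤ.+ b) (δ-dark {+ m} {i} (ℤ.<-≤-trans (+<+ m<l) l≤i))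
      (dark (η g) i (ℤ.<-≤-trans b<l l≤i))
    top : δ (+ l ℤ.- + l) ℤ.+ (ℤ.- δ (+ l ℤ.- + m) ℤ.+ lamp (η g) (+ l)) ≡ 1ℤ
    top = cong₂ ℤ._+_ (cong δ (ℤ.+-inverseʳ (+ l))) (rest (+ l) ℤ.≤-refl)
    above : ∀ i → + l ℤ.< i → δ (i ℤ.- + l) ℤ.+ (ℤ.- δ (i ℤ.- + m) ℤ.+ lamp (η g) i) ≡ 0ℤ
    above i l<i = cong₂ ℤ._+_ (δ-dark {+ l} {i} l<i) (rest i (ℤ.<⇒≤ l<i))

  -- Distinct powers of the generator have images at distinct positions.
  power-quotient≉ε : ∀ {i j} → j < i → ¬ (power F e₁ i ⁻¹ ∙ power F e₁ j ≈ ε)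
  power-quotient≉ε {i} {j} j<i eq = ℕ.<⇒≢ j<i (ℤ.+-injective
    (≡.trans (≡.sym (proj₂ (η-power j))) (≡.trans (proj₂ (η-cong eⱼ≈eᵢ)) (proj₂ (η-power i)))))
    where
    eⱼ≈eᵢ : power F e₁ j ≈ power F e₁ i
    eⱼ≈eᵢ = trans (inverseʳ-unique _ _ eq) (⁻¹-involutive _)

  alternating : Descent.Alternating em F D
  alternating g with em {D g}
  ... | yes d = (λ i → beacon (L i) ⁻¹) , (λ j → beacon (L j) ⁻¹ ∙ g) , (λ k → \\-leftDividesʳ _ g) ,
    λ {i} {j} j<i → (λ _ → beacon-¬D g (L i) (L j) (above i) (ℕ.+-monoʳ-< (suc ∣ bound (η g) ∣) j<i)) , contradiction d
    where
    L : ℕ → ℕ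
    -- The successor places every beacon strictly beyond the lamps of `g`, even the one with index
    -- 0.
    L i = suc ∣ bound (η g) ∣ ℕ.+ i
    above : ∀ i → bound (η g) ℤ.< + L i
    above i = ℤ.≤-<-trans (i≤∣i∣ (bound (η g))) (+<+ (ℕ.m≤m+n (suc ∣ bound (η g) ∣) i))
  -- With yᵢ = u e₁ⁱ u⁻¹ and xᵢ = yᵢ g⁻¹, the product xᵢ⁻¹yⱼ is g u e₁ʲ⁻ⁱ u⁻¹: it equals g on the
  -- diagonal and is a twist of g by a nontrivial power off it.
  ... | no ¬d = (λ i → y i ∙ g ⁻¹) , y , diag , λ {i} {j} j<i → (λ d → contradiction d ¬d) ,
    λ _ → D-intro g (power F e₁ i ⁻¹ ∙ power F e₁ j)
      (Commute-∙ F (Commute-⁻¹ F (Commute-power F e₁ i)) (Commute-power F e₁ j))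
      (power-quotient≉ε j<i) (off i j)
    where
    open SetoidReasoning setoid
    c : Carrier
    c = u e₁ g
    y : ℕ → Carrier
    y i = conjugate F c (power F e₁ i)
    shift : ∀ a b → (a ∙ g ⁻¹) ⁻¹ ∙ b ≈ g ∙ (a ⁻¹ ∙ b)
    shift a b = begin
      (a ∙ g ⁻¹) ⁻¹ ∙ b      ≈⟨ ∙-congʳ (⁻¹-anti-homo-// a g) ⟩
      g ∙ a ⁻¹ ∙ b           ≈⟨ assoc g (a ⁻¹) b ⟩
      g ∙ (a ⁻¹ ∙ b)         ∎
    diag : ∀ k → (y k ∙ g ⁻¹) ⁻¹ ∙ y k ≈ g
    diag k = trans (shift (y k) (y k)) (trans (∙-congˡ (inverseˡ (y k))) (identityʳ g))
    off : ∀ i j → (y i ∙ g ⁻¹) ⁻¹ ∙ y j ≈ twist e₁ g (power F e₁ i ⁻¹ ∙ power F e₁ j)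
    off i j = trans (shift (y i) (y j)) (∙-congˡ (trans (∙-congʳ (sym (⁻¹-homo _))) (sym (homo _ _))))
      where open GroupMorphisms.IsGroupHomomorphism (conjugate-hom F c) using (homo; ⁻¹-homo)

  notEquational : ¬ Equational (Th (groupStructure F))
  notEquational equational = notAlternating em equational twistFormula alternating

theorem3p7 : (X : Set) (F : Group 0ℓ 0ℓ) (ι : X → Group.Carrier F) →
    IsFreeOn X F ι → NonAbelian F →
    ¬ Equational (Th (groupStructure F))
theorem3p7 X F ι free (a , b , ab≉ba) equational =
  -- The goal is absurdity, so the double negation of excluded middle is as good as excluded middle.
  -- The two sides of the noncommuting product serve as distinct elements.
  equational⇒¬¬EM {Th M} {M} (λ _ p → p) {Group._∙_ F a b} {Group._∙_ F b a} ab≉ba equational λ em →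
    let x₁ , x₂ , x₁x₂≉x₂x₁ = FreeGroup.Words.noncommutingGenerators X F ι free em (a , b , ab≉ba)
    in NonabelianFree.notEquational X F ι free em x₁ x₂ x₁x₂≉x₂x₁ equational
  where
  M : Structure
  M = groupStructure F
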